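{- Let $\Gamma$ be a graph and let $n\geq 2$ be an integer. The following are equivalent: (i) $\Gamma$ is a connected locally $T_n$ graph; (ii) $\Gamma$ is a halved graph of $(Q_n)_K$ for some $K\leq \mathrm{Aut}(Q_n)$ such that $K$ is even and $d_K\geq 7$. Moreover, the group $K$ in (ii) is unique up to conjugacy in $\mathrm{Aut}(Q_n)$: if $\Gamma$ is a halved graph of $(Q_n)_K$ and of $(Q_n)_L$ where $K,L\leq\mathrm{Aut}(Q_n)$ are even with $d_K\geq 7$ and $d_L\geq 7$, then $K$ and $L$ are conjugate in $\mathrm{Aut}(Q_n)$.
   Context: All graphs are finite, simple and undirected. For $n\geq 2$ the triangular graph $T_n$ has vertex set the $2$-subsets of $\{1,\dots,n\}$, two $2$-subsets adjacent iff they intersect in exactly one point. A graph $\Gamma$ is locally $T_n$ if for every vertex $u$ the subgraph induced on the neighbourhood $\Gamma(u)$ is isomorphic to $T_n$. The $n$-cube $Q_n$ has vertex set $\mathbb{F}_2^n$, two vectors adjacent iff their Hamming distance is $1$. $\mathrm{Aut}(Q_n)=\mathbb{F}_2^n: S_n=\mathbb{F}_2\wr S_n$, where $\mathbb{F}_2^n$ acts by translation and $S_n$ by permuting coordinates; its elements are written $(x,\sigma)$ with $x\in\mathbb{F}_2^n$, $\sigma\in S_n$. $E_n$ denotes the subspace of vectors of even weight, and $K\leq \mathrm{Aut}(Q_n)$ is called even if $K\leq E_n: S_n$. For $K\leq\mathrm{Aut}(Q_n)$, $d_K:=\min\{d_{Q_n}(x,x^k): x\in\mathbb{F}_2^n,\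 1\neq k\in K\}$ if $K\neq 1$ and $d_K:=\infty$ if $K=1$. The normal quotient $(Q_n)_K$ is the simple graph whose vertices are the $K$-orbits $x^K$ on $\mathbb{F}_2^n$, distinct orbits being adjacent iff some vertex of one is adjacent in $Q_n$ to some vertex of the other. For a connected bipartite graph $\Pi$, the distance $2$ graph $\Pi_2$ (same vertex set, adjacency = distance exactly $2$ in $\Pi$) has exactly two connected components, called the halved graphs of $\Pi$. -}

module Defs where

open import Level using (0ℓ)
open import Data.Nat using (ℕ; _≤_)
open import Data.Nat.Divisibility using (_∣_)
open import Data.Bool using (Bool; true; false; _xor_)
import Data.Bool
open import Data.Fin using (Fin)
open import Data.Fin.Subset using (Subset; _∩_; ∣_∣)
open import Data.Fin.Permutation as P using (Permutation′; _⟨$⟩ʳ_; _⟨$⟩ˡ_; _∘ₚ_)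
open import Data.Vec using (Vec; lookup; tabulate; zipWith; replicate; count)
open import Data.Product using (Σ; ∃; _×_; _,_; proj₁; proj₂)
open import Relation.Nullary using (¬_)
open import Relation.Binary.PropositionalEquality using (_≡_; _≢_)
open import Function.Bundles using (_⇔_)

-- Raw graphs: a vertex type, a vertex "sameness" relation (an
-- equivalence, used to model quotients such as orbit sets) and an
-- adjacency relation.  All notions below are stated up to _≈_.

record RGraph : Set₁ where
  field
    V   : Set
    _≈_ : V → V → Set
    _~_ : V → V → Set

open RGraph public

finGraph : (m : ℕ) → (Fin m → Fin m → Set) → RGraph
finGraph m E = record { V = Fin m ; _≈_ = _≡_ ; _~_ = E }

data Walk (G : RGraph) : V G → V G → Set where
  here : ∀ {u v} → _≈_ G u v → Walk G u v
  step : ∀ {u w v} → _~_ G u w → Walk G w v → Walk G u v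

Connected : RGraph → Set
Connected G = V G × (∀ u v → Walk G u v)

Bipartite : RGraph → Set
Bipartite G = Σ (V G → Bool) λ c →
  (∀ u v → _≈_ G u v → c u ≡ c v) × (∀ u v → _~_ G u v → c u ≢ c v)

record Iso (G H : RGraph) : Set where
  field
    f       : V G → V H
    f-≈     : ∀ u v → _≈_ G u v ⇔ _≈_ H (f u) (f v)
    f-surj  : ∀ w → ∃ λ u → _≈_ H (f u) w
    f-adj   : ∀ u v → _~_ G u v ⇔ _~_ H (f u) (f v)

Induced : (G : RGraph) → (V G → Set) → RGraph
Induced G P = record
  { V = Σ (V G) P
  ; _≈_ = λ u v → _≈_ G (proj₁ u) (proj₁ v)
  ; _~_ = λ u v → _~_ G (proj₁ u) (proj₁ v) }

T : ℕ → RGraph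
T n = record
  { V = Σ (Subset n) (λ s → ∣ s ∣ ≡ 2)
  ; _≈_ = λ s t → proj₁ s ≡ proj₁ t
  ; _~_ = λ s t → ∣ proj₁ s ∩ proj₁ t ∣ ≡ 1 }

LocallyT : ℕ → RGraph → Set
LocallyT n G = ∀ u → Iso (Induced G (_~_ G u)) (T n)

Dist2 : RGraph → RGraph
Dist2 G = record
  { V = V G
  ; _≈_ = _≈_ G
  ; _~_ = λ u v → ¬ (_≈_ G u v) × ¬ (_~_ G u v) × ∃ λ w → _~_ G u w × _~_ G w v }

HalvedOf : RGraph → RGraph → Set
HalvedOf Γ Π = Connected Π × Bipartite Π ×
  ∃ λ v → Iso Γ (Induced (Dist2 Π) (Walk (Dist2 Π) v))

Vtx : ℕ → Set
Vtx n = Vec Bool n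

_⊕_ : ∀ {n} → Vtx n → Vtx n → Vtx n
_⊕_ = zipWith _xor_

weight : ∀ {n} → Vtx n → ℕ
weight = count (λ b → b Data.Bool.≟ true)

hamming : ∀ {n} → Vtx n → Vtx n → ℕ
hamming x y = weight (x ⊕ y)

-- Coordinate permutation: (w^σ)_{σ i} = w_i.
permute : ∀ {n} → Permutation′ n → Vtx n → Vtx n
permute σ w = tabulate λ j → lookup w (σ ⟨$⟩ˡ j)

-- Elements (x , σ) of Aut(Q_n) = F₂ⁿ : S_n.
Aut : ℕ → Set
Aut n = Vtx n × Permutation′ n

-- Right action on vertices: v^(x,σ) = (v + x)^σ.
act : ∀ {n} → Aut n → Vtx n → Vtx n
act (x , σ) v = permute σ (v ⊕ x)

-- Group operations (compatible with the right action above).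
e : ∀ {n} → Aut n
e = replicate _ false , P.id

_·_ : ∀ {n} → Aut n → Aut n → Aut n
(x , σ) · (y , τ) = (x ⊕ permute (P.flip σ) y) , (σ ∘ₚ τ)

_⁻¹ : ∀ {n} → Aut n → Aut n
(x , σ) ⁻¹ = permute σ x , P.flip σ

_≈ₐ_ : ∀ {n} → Aut n → Aut n → Set
(x , σ) ≈ₐ (y , τ) = x ≡ y × (∀ i → σ ⟨$⟩ʳ i ≡ τ ⟨$⟩ʳ i)

record Subgroup (n : ℕ) : Set₁ where
  field
    mem    : Aut n → Set
    resp   : ∀ {g h} → g ≈ₐ h → mem g → mem h
    has-e  : mem e
    closed : ∀ {g h} → mem g → mem h → mem (g · h)
    inv    : ∀ {g} → mem g → mem (g ⁻¹)

open Subgroup public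

Even : ∀ {n} → Subgroup n → Set
Even K = ∀ g → mem K g → 2 ∣ weight (proj₁ g)

-- d_K ≥ d  (with d_K = ∞ for K = 1; unfolding of the minimum).
dK≥ : ∀ {n} → Subgroup n → ℕ → Set
dK≥ K d = ∀ k → mem K k → ¬ (k ≈ₐ e) → ∀ x → d ≤ hamming x (act k x)

-- Normal quotient (Q_n)_K: vertices are K-orbits (vertex x standing for
-- x^K), distinct orbits adjacent iff some of their members are adjacent.
Quot : ∀ {n} → Subgroup n → RGraph
Quot {n} K = record
  { V = Vtx n
  ; _≈_ = λ x y → ∃ λ k → mem K k × act k x ≡ y
  ; _~_ = λ x y → ¬ (∃ λ k → mem K k × act k x ≡ y) ×
                  ∃ λ k → ∃ λ k′ → mem K k × mem K k′ × hamming (act k x) (act k′ y) ≡ 1 }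

Conjugate : ∀ {n} → Subgroup n → Subgroup n → Set
Conjugate {n} K L = ∃ λ (g : Aut n) → ∀ h → mem L h ⇔ mem K ((g · h) · (g ⁻¹))

{-# OPTIONS --safe #-}
-- For a locally T_n graph, label the n pairwise adjacent images of the cube
-- neighbours y + e_k of an odd vertex y. The labelling at y determines the one at
-- y + e_i + e_j, and these moves satisfy the relations of the even vectors under
-- addition, so they unfold to a map q from the halved cube onto the graph which is
-- an isomorphism on neighbourhoods and does not identify or join vertices at
-- distance 4. Hence q is injective up to distance 6, and for n ≥ 5 two such maps
-- that agree at a point differ by an element of Aut(Q_n), because Aut(T_n) = S_n. The
-- fibres of q are therefore the orbits of its deck group K, and d_K ≥ 7. Conversely
-- d_K ≥ 7 makes the projection to the halved quotient such a map q. Two quotient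
-- descriptions of the same graph give two such maps, so their groups are conjugate;
-- for n ≤ 6 the groups are trivial.
module Submission where

open import Defs
open import Data.Bool using (Bool; true; false; not; _xor_)
open import Data.Bool.Properties using (not-involutive; not-¬; xor-assoc; xor-same; xor-identityʳ)
import Data.Bool.Properties as Bool
open import Data.Fin using (Fin; zero; suc)
open import Data.Fin.Permutation as P using (Permutation′; _⟨$⟩ʳ_; _⟨$⟩ˡ_)
open import Data.Fin.Properties using (_≟_; any?; injective⇒≤)
open import Data.Fin.Subset using (Subset; _∩_; ∣_∣)
open import Data.List as List using (List; []; _∷_; length; map)
open import Data.List.Membership.DecPropositional using (_∈?_)
open import Data.List.Membership.Propositional using (_∈_)
open import Data.List.Membership.Propositional.Properties using (∈-tabulate⁻)
open import Data.List.Properties using (length-map; length-tabulate)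
open import Data.List.Relation.Unary.All as All using (All; []; _∷_)
import Data.List.Relation.Unary.All.Properties as All
open import Data.List.Relation.Unary.Any using (here; there; index)
open import Data.List.Relation.Unary.Any.Properties using (lookup-index)
open import Data.List.Relation.Unary.AllPairs using ([]; _∷_)
open import Data.List.Relation.Unary.Unique.Propositional using (Unique)
import Data.List.Relation.Unary.Unique.Propositional.Properties as Unique
open import Data.Nat using (ℕ; zero; suc; _+_; _*_; _≤_; _<_; z≤n; s≤s)
open import Data.Nat.Divisibility using (_∣_; divides)
import Data.Nat.Properties as ℕ
open import Data.Product using (Σ; ∃; ∃₂; _×_; _,_; proj₁; proj₂)
open import Data.Sum using (_⊎_; inj₁; inj₂)
open import Data.Vec using ([]; _∷_; lookup; replicate; tabulate; tail)
open import Data.Vec.Properties using (lookup∘tabulate; tabulate∘lookup; tabulate-cong; ≡-dec; lookup-zipWith; lookup-replicate; count≤n)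
open import Function using (_∘_; case_of_)
open import Function.Bundles using (_⇔_; Equivalence; mk⇔)
open import Relation.Binary.Definitions using (Symmetric)
open import Relation.Binary.PropositionalEquality using (_≡_; _≢_; refl; sym; trans; cong; cong₂; subst; subst₂; ≢-sym; module ≡-Reasoning)
open import Relation.Nullary using (¬_; Dec; yes; no; contradiction; ¬?)
open import Relation.Nullary.Decidable using (decidable-stable)

-- A clique rather than a chart is transported because it belongs to no single vertex: the star of
-- one label determines a whole chart, so the same n vertices can be read in the chart at each of
-- them. The obstacle is that the clique must look like a star and not like a triangle of pairs; for
-- n = 4 both have the same size, and the chart may have to be replaced by its complement. Since
-- parity determines one coordinate, the even vectors are generated by the n - 1 commuting
-- involutions e_0 + e_k, and a well-defined map needs only that the corresponding moves are
-- involutive and commute. The bound 7 comes from 6 = 2 + 4: identifying vectors at distance 6 would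
-- make images at distance 4 adjacent, and conversely adjacent classes at distance 4 would put
-- vectors at most 6 apart into one orbit. A halved graph may consist of the even or of the odd
-- classes, so a cover carries the parity `b` of the vectors on which it is read.

private variable
  n : ℕ

-- Vectors of the cube and paths of flips

origin : Vtx n
origin = replicate _ false

flip : Fin n → Vtx n → Vtx n
flip zero    (b ∷ x) = not b ∷ x
flip (suc i) (b ∷ x) = b ∷ flip i x

flips : List (Fin n) → Vtx n → Vtx n
flips []       x = x
flips (i ∷ is) x = flip i (flips is x)

≡-ext : {x y : Vtx n} → (∀ i → lookup x i ≡ lookup y i) → x ≡ y
≡-ext {x = x} {y} h = begin
  x                   ≡⟨ tabulate∘lookup x ⟨
  tabulate (lookup x) ≡⟨ tabulate-cong h ⟩
  tabulate (lookup y) ≡⟨ tabulate∘lookup y ⟩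
  y                   ∎
  where open ≡-Reasoning

flip-involutive : (i : Fin n) (x : Vtx n) → flip i (flip i x) ≡ x
flip-involutive zero    (b ∷ x) = cong (_∷ x) (not-involutive b)
flip-involutive (suc i) (b ∷ x) = cong (b ∷_) (flip-involutive i x)

flip-comm : (i j : Fin n) (x : Vtx n) → flip i (flip j x) ≡ flip j (flip i x)
flip-comm zero    zero    (b ∷ x) = refl
flip-comm zero    (suc j) (b ∷ x) = refl
flip-comm (suc i) zero    (b ∷ x) = refl
flip-comm (suc i) (suc j) (b ∷ x) = cong (b ∷_) (flip-comm i j x)

lookup-flip : (i : Fin n) (x : Vtx n) → lookup (flip i x) i ≡ not (lookup x i)
lookup-flip zero    (b ∷ x) = refl
lookup-flip (suc i) (b ∷ x) = lookup-flip i x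

lookup-flip-≢ : {i j : Fin n} → j ≢ i → (x : Vtx n) → lookup (flip i x) j ≡ lookup x j
lookup-flip-≢ {i = zero}  {zero}  j≢i (b ∷ x) = contradiction refl j≢i
lookup-flip-≢ {i = zero}  {suc j} j≢i (b ∷ x) = refl
lookup-flip-≢ {i = suc i} {zero}  j≢i (b ∷ x) = refl
lookup-flip-≢ {i = suc i} {suc j} j≢i (b ∷ x) = lookup-flip-≢ (j≢i ∘ cong suc) x

flip-cancelˡ : (i j : Fin n) (x : Vtx n) → flip i (flip j (flip i x)) ≡ flip j x
flip-cancelˡ i j x = trans (flip-comm i j (flip i x)) (cong (flip j) (flip-involutive i x))

-- The pairs `ij` and `ik` have symmetric difference `jk`; hence neighbours labelled by meeting
-- pairs are again at distance 2.
flip-exchange : ∀ (i j k : Fin n) x → flip j (flip k (flip i (flip j x))) ≡ flip i (flip k x)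
flip-exchange i j k x = begin
  flip j (flip k (flip i (flip j x))) ≡⟨ cong (flip j ∘ flip k) (flip-comm i j x) ⟩
  flip j (flip k (flip j (flip i x))) ≡⟨ flip-cancelˡ j k (flip i x) ⟩
  flip k (flip i x)                   ≡⟨ flip-comm k i x ⟩
  flip i (flip k x)                   ∎
  where open ≡-Reasoning

flip-label-injective : (z : Vtx n) {i j : Fin n} → flip i z ≡ flip j z → i ≡ j
flip-label-injective z {i} {j} p with i ≟ j
... | yes i≡j = i≡j
... | no i≢j  = contradiction
  (trans (sym (lookup-flip-≢ i≢j z))
    (trans (sym (cong (λ w → lookup w i) p)) (lookup-flip i z)))
  (not-¬ refl)

flips-flip : (is : List (Fin n)) (i : Fin n) (x : Vtx n) →
  flips is (flip i x) ≡ flip i (flips is x)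
flips-flip []       i x = refl
flips-flip (j ∷ is) i x = trans (cong (flip j) (flips-flip is i x)) (flip-comm j i _)

flips-involutive : (is : List (Fin n)) (x : Vtx n) → flips is (flips is x) ≡ x
flips-involutive []       x = refl
flips-involutive (i ∷ is) x = begin
  flip i (flips is (flip i (flips is x))) ≡⟨ cong (flip i) (flips-flip is i _) ⟩
  flip i (flip i (flips is (flips is x))) ≡⟨ flip-involutive i _ ⟩
  flips is (flips is x)                   ≡⟨ flips-involutive is x ⟩
  x                                       ∎
  where open ≡-Reasoning

lookup-flips : (is : List (Fin n)) (x : Vtx n) {j : Fin n} → All (j ≢_) is →
  lookup (flips is x) j ≡ lookup x j
lookup-flips []       x []           = refl
lookup-flips (i ∷ is) x (j≢i ∷ j∉is) =
  trans (lookup-flip-≢ j≢i _) (lookup-flips is x j∉is)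

hamming-refl : (x : Vtx n) → hamming x x ≡ 0
hamming-refl []          = refl
hamming-refl (false ∷ x) = hamming-refl x
hamming-refl (true ∷ x)  = hamming-refl x

hamming-flip-≤ : (i : Fin n) (x y : Vtx n) → hamming x (flip i y) ≤ suc (hamming x y)
hamming-flip-≤ zero    (false ∷ x) (false ∷ y) = ℕ.≤-refl
hamming-flip-≤ zero    (false ∷ x) (true ∷ y)  = ℕ.m≤n⇒m≤1+n (ℕ.n≤1+n _)
hamming-flip-≤ zero    (true ∷ x)  (false ∷ y) = ℕ.m≤n⇒m≤1+n (ℕ.n≤1+n _)
hamming-flip-≤ zero    (true ∷ x)  (true ∷ y)  = ℕ.≤-refl
hamming-flip-≤ (suc i) (false ∷ x) (false ∷ y) = hamming-flip-≤ i x y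
hamming-flip-≤ (suc i) (false ∷ x) (true ∷ y)  = s≤s (hamming-flip-≤ i x y)
hamming-flip-≤ (suc i) (true ∷ x)  (false ∷ y) = s≤s (hamming-flip-≤ i x y)
hamming-flip-≤ (suc i) (true ∷ x)  (true ∷ y)  = hamming-flip-≤ i x y

hamming-flip : (i : Fin n) (x y : Vtx n) → lookup y i ≡ lookup x i →
  hamming x (flip i y) ≡ suc (hamming x y)
hamming-flip zero    (false ∷ x) (.false ∷ y) refl = refl
hamming-flip zero    (true ∷ x)  (.true ∷ y)  refl = refl
hamming-flip (suc i) (false ∷ x) (false ∷ y)  p    = hamming-flip i x y p
hamming-flip (suc i) (false ∷ x) (true ∷ y)   p    = cong suc (hamming-flip i x y p)
hamming-flip (suc i) (true ∷ x)  (false ∷ y)  p    = cong suc (hamming-flip i x y p)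
hamming-flip (suc i) (true ∷ x)  (true ∷ y)   p    = hamming-flip i x y p

hamming-flips-≤ : (is : List (Fin n)) (x : Vtx n) → hamming x (flips is x) ≤ length is
hamming-flips-≤ []       x = ℕ.≤-reflexive (hamming-refl x)
hamming-flips-≤ (i ∷ is) x = ℕ.≤-trans (hamming-flip-≤ i x _) (s≤s (hamming-flips-≤ is x))

hamming-flips : {is : List (Fin n)} → Unique is → (x : Vtx n) →
  hamming x (flips is x) ≡ length is
hamming-flips []            x = hamming-refl x
hamming-flips (i∉is ∷ uniq) x =
  trans (hamming-flip _ x _ (lookup-flips _ x i∉is)) (cong suc (hamming-flips uniq x))

flips-map-suc : (is : List (Fin n)) (b : Bool) (x : Vtx n) →
  flips (map suc is) (b ∷ x) ≡ b ∷ flips is x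
flips-map-suc []       b x = refl
flips-map-suc (i ∷ is) b x = cong (flip (suc i)) (flips-map-suc is b x)

-- The support of `x ⊕ y` as a duplicate-free list, that is, a shortest path from `x` to `y`.
-- Matching on the list gives the case distinctions on small distances.
Differ : (x y : Vtx n) → Set
Differ {n} x y = ∃ λ (is : List (Fin n)) → Unique is × flips is x ≡ y × length is ≡ hamming x y

differ : (x y : Vtx n) → Differ x y
differ []      []       = [] , [] , refl , refl
differ (b ∷ x) (b′ ∷ y) with differ x y
... | is , uniq , eq , len = go b b′
  where
  uniq′ : Unique (map suc is)
  uniq′ = Unique.map⁺ (λ { refl → refl }) uniq
  len′ : length (map {B = Fin (suc _)} suc is) ≡ hamming x y
  len′ = trans (length-map suc is) len
  eq′ : ∀ c → flips (map suc is) (c ∷ x) ≡ c ∷ y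
  eq′ c = trans (flips-map-suc is c x) (cong (c ∷_) eq)
  0∉ : All (zero ≢_) (map {B = Fin (suc _)} suc is)
  0∉ = All.map⁺ (All.universal (λ _ ()) is)
  go : ∀ b b′ → Differ (b ∷ x) (b′ ∷ y)
  go false false = map suc is , uniq′ , eq′ false , len′
  go true  true  = map suc is , uniq′ , eq′ true , len′
  go false true  = zero ∷ map suc is , 0∉ ∷ uniq′ , cong (flip zero) (eq′ false) , cong suc len′
  go true  false = zero ∷ map suc is , 0∉ ∷ uniq′ , cong (flip zero) (eq′ true) , cong suc len′

-- Parity and the halved cube

odd : ℕ → Bool
odd zero    = false
odd (suc k) = not (odd k)

even⇒2∣ : ∀ k → odd k ≡ false → 2 ∣ k
even⇒2∣ zero          _  = divides 0 refl
even⇒2∣ (suc zero)    ()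
even⇒2∣ (suc (suc k)) p with even⇒2∣ k (trans (sym (not-involutive (odd k))) p)
... | divides q eq = divides (suc q) (cong (λ m → suc (suc m)) eq)

2∣⇒even : ∀ {k} → 2 ∣ k → odd k ≡ false
2∣⇒even (divides q refl) = go q
  where
  go : ∀ q → odd (q * 2) ≡ false
  go zero    = refl
  go (suc q) = trans (not-involutive (odd (q * 2))) (go q)

parity : Vtx n → Bool
parity []      = false
parity (b ∷ x) = b xor parity x

parity≡odd-weight : (x : Vtx n) → parity x ≡ odd (weight x)
parity≡odd-weight []          = refl
parity≡odd-weight (false ∷ x) = parity≡odd-weight x
parity≡odd-weight (true ∷ x)  = cong not (parity≡odd-weight x)

parity-origin : ∀ n → parity (origin {n}) ≡ false
parity-origin zero    = refl
parity-origin (suc n) = parity-origin n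

parity-flip : (i : Fin n) (x : Vtx n) → parity (flip i x) ≡ not (parity x)
parity-flip zero    (false ∷ x) = refl
parity-flip zero    (true ∷ x)  = sym (not-involutive _)
parity-flip (suc i) (false ∷ x) = parity-flip i x
parity-flip (suc i) (true ∷ x)  = cong not (parity-flip i x)

parity-flip² : (i j : Fin n) (x : Vtx n) → parity (flip i (flip j x)) ≡ parity x
parity-flip² i j x =
  trans (parity-flip i _) (trans (cong not (parity-flip j x)) (not-involutive _))

parity-flips : (is : List (Fin n)) (x : Vtx n) →
  parity (flips is x) ≡ odd (length is) xor parity x
parity-flips []       x = refl
parity-flips (i ∷ is) x = trans (parity-flip i _) (trans (cong not (parity-flips is x)) (go (odd (length is)) _))
  where
  go : ∀ b c → not (b xor c) ≡ not b xor c
  go false c = refl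
  go true  c = not-involutive c

xor-cancelʳ : ∀ {b c} → b xor c ≡ c → b ≡ false
xor-cancelʳ {false}         _  = refl
xor-cancelʳ {true}  {false} ()
xor-cancelʳ {true}  {true}  ()

parity-≡⇒even-length : (is : List (Fin n)) (x : Vtx n) → parity (flips is x) ≡ parity x →
  odd (length is) ≡ false
parity-≡⇒even-length is x p = xor-cancelʳ (trans (sym (parity-flips is x)) p)

-- Connectedness of the halved cube as an induction principle: a shortest path between vectors of
-- equal parity has even length, so its flips are taken two at a time, with distinct labels because
-- the list has no repetitions.
parity-induction : (P : Vtx n → Set) →
  (∀ {i j} → i ≢ j → ∀ x → P x → P (flip i (flip j x))) →
  ∀ {x y} → parity y ≡ parity x → P x → P y
parity-induction P P-flip² {x} {y} p Px with differ x y
... | is , uniq , refl , _ = go is uniq (parity-≡⇒even-length is x p)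
  where
  go : ∀ is → Unique is → odd (length is) ≡ false → P (flips is x)
  go []           _                           _  = Px
  go (i ∷ [])     _                           ()
  go (i ∷ j ∷ is) ((i≢j ∷ _) ∷ (_ ∷ uniq)) q =
    P-flip² i≢j _ (go is uniq (trans (sym (not-involutive _)) q))

parity-⊕ : (x y : Vtx n) → parity (x ⊕ y) ≡ parity x xor parity y
parity-⊕ []      []      = refl
parity-⊕ (b ∷ x) (c ∷ y) = trans (cong ((b xor c) xor_) (parity-⊕ x y)) (go b c (parity x) (parity y))
  where
  go : ∀ b c p q → (b xor c) xor (p xor q) ≡ (b xor p) xor (c xor q)
  go false false p     q = refl
  go false true  false q = refl
  go false true  true  q = refl
  go true  false false q = refl
  go true  false true  q = not-involutive q
  go true  true  false q = sym (not-involutive q)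
  go true  true  true  q = refl

-- The action of Aut(Q_n)

lookup-permute : (σ : Permutation′ n) (x : Vtx n) (j : Fin n) →
  lookup (permute σ x) j ≡ lookup x (σ ⟨$⟩ˡ j)
lookup-permute σ x j = lookup∘tabulate _ j

lookup-act : (g : Aut n) (v : Vtx n) (j : Fin n) →
  lookup (act g v) j ≡ lookup v (proj₂ g ⟨$⟩ˡ j) xor lookup (proj₁ g) (proj₂ g ⟨$⟩ˡ j)
lookup-act (x , σ) v j = trans (lookup-permute σ (v ⊕ x) j) (lookup-zipWith _xor_ _ v x)

permute-flip : (σ : Permutation′ n) (i : Fin n) (x : Vtx n) →
  permute σ (flip i x) ≡ flip (σ ⟨$⟩ʳ i) (permute σ x)
permute-flip σ i x = ≡-ext go
  where
  go : ∀ j → lookup (permute σ (flip i x)) j ≡ lookup (flip (σ ⟨$⟩ʳ i) (permute σ x)) j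
  go j with j ≟ σ ⟨$⟩ʳ i
  ... | yes refl = begin
    lookup (permute σ (flip i x)) (σ ⟨$⟩ʳ i) ≡⟨ lookup-permute σ (flip i x) _ ⟩
    lookup (flip i x) (σ ⟨$⟩ˡ (σ ⟨$⟩ʳ i))     ≡⟨ cong (lookup (flip i x)) (P.inverseˡ σ) ⟩
    lookup (flip i x) i                     ≡⟨ lookup-flip i x ⟩
    not (lookup x i)                        ≡⟨ cong (not ∘ lookup x) (P.inverseˡ σ) ⟨
    not (lookup x (σ ⟨$⟩ˡ (σ ⟨$⟩ʳ i)))        ≡⟨ cong not (lookup-permute σ x _) ⟨
    not (lookup (permute σ x) (σ ⟨$⟩ʳ i))    ≡⟨ lookup-flip _ (permute σ x) ⟨
    lookup (flip (σ ⟨$⟩ʳ i) (permute σ x)) (σ ⟨$⟩ʳ i) ∎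
    where open ≡-Reasoning
  ... | no j≢ = begin
    lookup (permute σ (flip i x)) j          ≡⟨ lookup-permute σ (flip i x) j ⟩
    lookup (flip i x) (σ ⟨$⟩ˡ j)              ≡⟨ lookup-flip-≢ (λ p → j≢ (trans (sym (P.inverseʳ σ)) (cong (σ ⟨$⟩ʳ_) p))) x ⟩
    lookup x (σ ⟨$⟩ˡ j)                       ≡⟨ lookup-permute σ x j ⟨
    lookup (permute σ x) j                   ≡⟨ lookup-flip-≢ j≢ (permute σ x) ⟨
    lookup (flip (σ ⟨$⟩ʳ i) (permute σ x)) j  ∎
    where open ≡-Reasoning

flip-⊕ : (i : Fin n) (x y : Vtx n) → flip i x ⊕ y ≡ flip i (x ⊕ y)
flip-⊕ zero    (false ∷ x) (b ∷ y) = refl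
flip-⊕ zero    (true ∷ x)  (b ∷ y) = cong (_∷ (x ⊕ y)) (sym (not-involutive b))
flip-⊕ (suc i) (a ∷ x)     (b ∷ y) = cong ((a xor b) ∷_) (flip-⊕ i x y)

act-flip : (g : Aut n) (i : Fin n) (x : Vtx n) →
  act g (flip i x) ≡ flip (proj₂ g ⟨$⟩ʳ i) (act g x)
act-flip (y , σ) i x = trans (cong (permute σ) (flip-⊕ i x y)) (permute-flip σ i (x ⊕ y))

act-flip² : (g : Aut n) (i j : Fin n) (x : Vtx n) →
  act g (flip i (flip j x)) ≡ flip (proj₂ g ⟨$⟩ʳ i) (flip (proj₂ g ⟨$⟩ʳ j) (act g x))
act-flip² g i j x = trans (act-flip g i (flip j x)) (cong (flip _) (act-flip g j x))

act-e : (x : Vtx n) → act e x ≡ x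
act-e x = ≡-ext λ j → trans (lookup-act e x j)
  (trans (cong (lookup x j xor_) (lookup-replicate j false)) (xor-identityʳ _))

act-· : (g h : Aut n) (v : Vtx n) → act (g · h) v ≡ act h (act g v)
act-· g@(x , σ) h@(y , τ) v = ≡-ext λ j → begin
  lookup (act (g · h) v) j
    ≡⟨ lookup-act (g · h) v j ⟩
  lookup v (k j) xor lookup (x ⊕ permute (P.flip σ) y) (k j)
    ≡⟨ cong (lookup v (k j) xor_) (lookup-zipWith _xor_ (k j) x _) ⟩
  lookup v (k j) xor (lookup x (k j) xor lookup (permute (P.flip σ) y) (k j))
    ≡⟨ xor-assoc (lookup v (k j)) _ _ ⟨
  (lookup v (k j) xor lookup x (k j)) xor lookup (permute (P.flip σ) y) (k j)
    ≡⟨ cong ((lookup v (k j) xor lookup x (k j)) xor_) (trans (lookup-permute (P.flip σ) y (k j)) (cong (lookup y) (P.inverseʳ σ))) ⟩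
  (lookup v (k j) xor lookup x (k j)) xor lookup y (τ ⟨$⟩ˡ j)
    ≡⟨ cong (_xor lookup y (τ ⟨$⟩ˡ j)) (lookup-act g v (τ ⟨$⟩ˡ j)) ⟨
  lookup (act g v) (τ ⟨$⟩ˡ j) xor lookup y (τ ⟨$⟩ˡ j)
    ≡⟨ lookup-act h (act g v) j ⟨
  lookup (act h (act g v)) j ∎
  where
  open ≡-Reasoning
  k : _ → _
  k j = σ ⟨$⟩ˡ (τ ⟨$⟩ˡ j)

act-⁻¹-act : (g : Aut n) (v : Vtx n) → act (g ⁻¹) (act g v) ≡ v
act-⁻¹-act g@(x , σ) v = ≡-ext λ j → begin
  lookup (act (g ⁻¹) (act g v)) j
    ≡⟨ lookup-act (g ⁻¹) (act g v) j ⟩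
  lookup (act g v) (σ ⟨$⟩ʳ j) xor lookup (permute σ x) (σ ⟨$⟩ʳ j)
    ≡⟨ cong₂ _xor_ (lookup-act g v _) (lookup-permute σ x _) ⟩
  (lookup v (k j) xor lookup x (k j)) xor lookup x (k j)
    ≡⟨ xor-assoc (lookup v (k j)) _ _ ⟩
  lookup v (k j) xor (lookup x (k j) xor lookup x (k j))
    ≡⟨ cong (lookup v (k j) xor_) (xor-same (lookup x (k j))) ⟩
  lookup v (k j) xor false
    ≡⟨ xor-identityʳ _ ⟩
  lookup v (k j)
    ≡⟨ cong (lookup v) (P.inverseˡ σ) ⟩
  lookup v j ∎
  where
  open ≡-Reasoning
  k : _ → _
  k j = σ ⟨$⟩ˡ (σ ⟨$⟩ʳ j)

act-act-⁻¹ : (g : Aut n) (v : Vtx n) → act g (act (g ⁻¹) v) ≡ v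
act-act-⁻¹ g@(x , σ) v = ≡-ext λ j → begin
  lookup (act g (act (g ⁻¹) v)) j
    ≡⟨ lookup-act g (act (g ⁻¹) v) j ⟩
  lookup (act (g ⁻¹) v) (σ ⟨$⟩ˡ j) xor lookup x (σ ⟨$⟩ˡ j)
    ≡⟨ cong (_xor lookup x (σ ⟨$⟩ˡ j)) (lookup-act (g ⁻¹) v _) ⟩
  (lookup v (k j) xor lookup (permute σ x) (k j)) xor lookup x (σ ⟨$⟩ˡ j)
    ≡⟨ cong (λ b → (lookup v (k j) xor b) xor lookup x (σ ⟨$⟩ˡ j)) (trans (lookup-permute σ x _) (cong (lookup x) (P.inverseˡ σ))) ⟩
  (lookup v (k j) xor lookup x (σ ⟨$⟩ˡ j)) xor lookup x (σ ⟨$⟩ˡ j)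
    ≡⟨ xor-assoc (lookup v (k j)) _ _ ⟩
  lookup v (k j) xor (lookup x (σ ⟨$⟩ˡ j) xor lookup x (σ ⟨$⟩ˡ j))
    ≡⟨ cong (lookup v (k j) xor_) (xor-same (lookup x (σ ⟨$⟩ˡ j))) ⟩
  lookup v (k j) xor false
    ≡⟨ xor-identityʳ _ ⟩
  lookup v (k j)
    ≡⟨ cong (lookup v) (P.inverseʳ σ) ⟩
  lookup v j ∎
  where
  open ≡-Reasoning
  k : _ → _
  k j = σ ⟨$⟩ʳ (σ ⟨$⟩ˡ j)

act-injective : (g : Aut n) {x y : Vtx n} → act g x ≡ act g y → x ≡ y
act-injective g {x} {y} p =
  trans (sym (act-⁻¹-act g x)) (trans (cong (act (g ⁻¹)) p) (act-⁻¹-act g y))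

-- Once the coordinate permutation is prescribed, the translation part is obtained by solving σ(x +
-- t) = y for t.
act-carry : (σ : Permutation′ n) (x y : Vtx n) → act (x ⊕ permute (P.flip σ) y , σ) x ≡ y
act-carry σ x y = ≡-ext λ j → begin
  lookup (act (x ⊕ permute (P.flip σ) y , σ) x) j
    ≡⟨ lookup-act (x ⊕ permute (P.flip σ) y , σ) x j ⟩
  lookup x (σ ⟨$⟩ˡ j) xor lookup (x ⊕ permute (P.flip σ) y) (σ ⟨$⟩ˡ j)
    ≡⟨ cong (lookup x (σ ⟨$⟩ˡ j) xor_) (lookup-zipWith _xor_ (σ ⟨$⟩ˡ j) x (permute (P.flip σ) y)) ⟩
  lookup x (σ ⟨$⟩ˡ j) xor (lookup x (σ ⟨$⟩ˡ j) xor lookup (permute (P.flip σ) y) (σ ⟨$⟩ˡ j))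
    ≡⟨ xor-assoc (lookup x (σ ⟨$⟩ˡ j)) _ _ ⟨
  (lookup x (σ ⟨$⟩ˡ j) xor lookup x (σ ⟨$⟩ˡ j)) xor lookup (permute (P.flip σ) y) (σ ⟨$⟩ˡ j)
    ≡⟨ cong (_xor lookup (permute (P.flip σ) y) (σ ⟨$⟩ˡ j)) (xor-same (lookup x (σ ⟨$⟩ˡ j))) ⟩
  lookup (permute (P.flip σ) y) (σ ⟨$⟩ˡ j)
    ≡⟨ lookup-permute (P.flip σ) y (σ ⟨$⟩ˡ j) ⟩
  lookup y (σ ⟨$⟩ʳ (σ ⟨$⟩ˡ j))
    ≡⟨ cong (lookup y) (P.inverseʳ σ) ⟩
  lookup y j ∎
  where open ≡-Reasoning

act-cong : {g h : Aut n} → g ≈ₐ h → ∀ v → act g v ≡ act h v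
act-cong {g = x , σ} {h = .x , τ} (refl , σ≈τ) v = tabulate-cong λ j → cong (lookup (v ⊕ x)) (begin
  σ ⟨$⟩ˡ j                   ≡⟨ cong (σ ⟨$⟩ˡ_) (P.inverseʳ τ) ⟨
  σ ⟨$⟩ˡ (τ ⟨$⟩ʳ (τ ⟨$⟩ˡ j))  ≡⟨ cong (σ ⟨$⟩ˡ_) (σ≈τ _) ⟨
  σ ⟨$⟩ˡ (σ ⟨$⟩ʳ (τ ⟨$⟩ˡ j))  ≡⟨ P.inverseˡ σ ⟩
  τ ⟨$⟩ˡ j                   ∎)
  where open ≡-Reasoning

-- Follow a path from `origin`, which every permutation fixes: each flip changes the parity on both
-- sides.
parity-permute : (σ : Permutation′ n) (x : Vtx n) → parity (permute σ x) ≡ parity x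
parity-permute {n} σ x with differ origin x
... | is , _ , refl , _ = go is
  where
  o : Vtx n
  o = origin
  permute-o : permute σ o ≡ o
  permute-o = ≡-ext λ j → trans (lookup-permute σ o j)
    (trans (lookup-replicate (σ ⟨$⟩ˡ j) false) (sym (lookup-replicate j false)))
  go : ∀ is → parity (permute σ (flips is o)) ≡ parity (flips is o)
  go []       = cong parity permute-o
  go (i ∷ is) = begin
    parity (permute σ (flip i (flips is o)))               ≡⟨ cong parity (permute-flip σ i (flips is o)) ⟩
    parity (flip (σ ⟨$⟩ʳ i) (permute σ (flips is o)))      ≡⟨ parity-flip (σ ⟨$⟩ʳ i) (permute σ (flips is o)) ⟩
    not (parity (permute σ (flips is o)))                  ≡⟨ cong not (go is) ⟩
    not (parity (flips is o))                              ≡⟨ parity-flip i (flips is o) ⟨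
    parity (flip i (flips is o))                           ∎
    where open ≡-Reasoning

parity-act : (g : Aut n) (x : Vtx n) → parity (act g x) ≡ parity x xor parity (proj₁ g)
parity-act (y , σ) x = trans (parity-permute σ (x ⊕ y)) (parity-⊕ x y)

-- The values at the neighbours of `origin` reveal the permutation; after that the value at `origin`
-- reveals the translation.
act-faithful : {g h : Aut n} → (∀ v → act g v ≡ act h v) → g ≈ₐ h
act-faithful {n} {g@(x , σ)} {h@(y , τ)} p = translations , labels
  where
  open ≡-Reasoning
  o : Vtx n
  o = origin
  labels : ∀ i → σ ⟨$⟩ʳ i ≡ τ ⟨$⟩ʳ i
  labels i = flip-label-injective (act g o) (begin
    flip (σ ⟨$⟩ʳ i) (act g o) ≡⟨ act-flip g i o ⟨
    act g (flip i o)          ≡⟨ p (flip i o) ⟩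
    act h (flip i o)          ≡⟨ act-flip h i o ⟩
    flip (τ ⟨$⟩ʳ i) (act h o) ≡⟨ cong (flip _) (p o) ⟨
    flip (τ ⟨$⟩ʳ i) (act g o) ∎)
  translations : x ≡ y
  translations = ≡-ext λ j → begin
    lookup x j                ≡⟨ cong (λ b → b xor lookup x j) (lookup-replicate j false) ⟨
    lookup o j xor lookup x j ≡⟨ lookup-zipWith _xor_ j o x ⟨
    lookup (o ⊕ x) j          ≡⟨ cong (λ v → lookup v j) (act-injective (o , σ) {o ⊕ x} {o ⊕ y} o⊕) ⟩
    lookup (o ⊕ y) j          ≡⟨ lookup-zipWith _xor_ j o y ⟩
    lookup o j xor lookup y j ≡⟨ cong (λ b → b xor lookup y j) (lookup-replicate j false) ⟩
    lookup y j                ∎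
    where
    lift : (ρ : Permutation′ n) (v : Vtx n) → act (o , ρ) v ≡ permute ρ v
    lift ρ v = cong (permute ρ) {v ⊕ o} {v} (≡-ext λ k → trans (lookup-zipWith _xor_ k v o)
      (trans (cong (lookup v k xor_) (lookup-replicate k false)) (xor-identityʳ _)))
    o⊕ : act (o , σ) (o ⊕ x) ≡ act (o , σ) (o ⊕ y)
    o⊕ = begin
      act (o , σ) (o ⊕ x) ≡⟨ lift σ (o ⊕ x) ⟩
      permute σ (o ⊕ x)   ≡⟨ p o ⟩
      permute τ (o ⊕ y)   ≡⟨ lift τ (o ⊕ y) ⟨
      act (o , τ) (o ⊕ y) ≡⟨ act-cong {g = o , τ} {h = o , σ} (refl , λ i → sym (labels i)) (o ⊕ y) ⟩
      act (o , σ) (o ⊕ y) ∎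

-- Counting labels

hamming-≤ : (x y : Vtx n) → hamming x y ≤ n
hamming-≤ x y = count≤n (λ b → b Bool.≟ true) (x ⊕ y)

unique-length-≤ : {is : List (Fin n)} → Unique is → length is ≤ n
unique-length-≤ {n} {is} uniq = subst (_≤ n) (hamming-flips uniq origin) (hamming-≤ origin (flips is origin))

abstract
  exhaust : {is : List (Fin n)} → Unique is → n ≤ length is → ∀ j → j ∈ is
  exhaust {is = is} uniq n≤ j with _∈?_ _≟_ j is
  ... | yes j∈ = j∈
  ... | no j∉  = contradiction (ℕ.≤-trans (unique-length-≤ (All.¬Any⇒All¬ is j∉ ∷ uniq)) n≤) ℕ.1+n≰n

  -- If every label occurred, its position in the list would inject `Fin n` into fewer than n
  -- positions.
  fresh : (is : List (Fin n)) → length is < n → ∃ λ j → All (j ≢_) is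
  fresh {n} is len< with any? (λ j → ¬? (_∈?_ _≟_ j is))
  ... | yes (j , j∉) = j , All.¬Any⇒All¬ is j∉
  ... | no ¬∃       = contradiction len< (ℕ.≤⇒≯ (injective⇒≤ {f = λ j → index (occurs j)} index-injective))
    where
    occurs : ∀ j → j ∈ is
    occurs j with _∈?_ _≟_ j is
    ... | yes j∈ = j∈
    ... | no j∉  = contradiction (j , j∉) ¬∃
    index-injective : ∀ {j k} → index (occurs j) ≡ index (occurs k) → j ≡ k
    index-injective {j} {k} p =
      trans (lookup-index (occurs j)) (trans (cong (List.lookup is) p) (sym (lookup-index (occurs k))))

injective⇒permutation : (s : Fin n → Fin n) → (∀ {i j} → s i ≡ s j → i ≡ j) →
  ∃ λ (σ : Permutation′ n) → ∀ i → σ ⟨$⟩ʳ i ≡ s i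
injective⇒permutation {n} s s-injective =
  P.permutation s (proj₁ ∘ preimage) (proj₂ ∘ preimage) (λ i → s-injective (proj₂ (preimage (s i)))) , λ _ → refl
  where
  preimage : ∀ j → ∃ λ i → s i ≡ j
  preimage j with ∈-tabulate⁻ {f = s} (exhaust (Unique.tabulate⁺ s-injective) (ℕ.≤-reflexive (sym (length-tabulate s))) j)
  ... | i , j≡si = i , sym j≡si

unique₄ : {i j k l : Fin n} → i ≢ j → i ≢ k → i ≢ l → j ≢ k → j ≢ l → k ≢ l →
  Unique (i ∷ j ∷ k ∷ l ∷ [])
unique₄ i≢j i≢k i≢l j≢k j≢l k≢l = (i≢j ∷ i≢k ∷ i≢l ∷ []) ∷ (j≢k ∷ j≢l ∷ []) ∷ (k≢l ∷ []) ∷ [] ∷ []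

-- Labellings of local graphs by T_n

-- As sets, two pairs are equal, meet in a point or are disjoint; the finer split records where the
-- common point stands in each ordered pair.
data Pairs {n} (i j : Fin n) : Fin n → Fin n → Set where
  same   : Pairs i j i j
  swap   : Pairs i j j i
  meetˡˡ : ∀ {l} → i ≢ l → j ≢ l → Pairs i j i l
  meetˡʳ : ∀ {k} → i ≢ k → j ≢ k → Pairs i j k i
  meetʳˡ : ∀ {l} → i ≢ l → j ≢ l → Pairs i j j l
  meetʳʳ : ∀ {k} → i ≢ k → j ≢ k → Pairs i j k j
  apart  : ∀ {k l} → i ≢ k → i ≢ l → j ≢ k → j ≢ l → Pairs i j k l

pairs : {i j k l : Fin n} → i ≢ j → k ≢ l → Pairs i j k l
pairs {i = i} {j} {k} {l} i≢j k≢l with i ≟ k | i ≟ l | j ≟ k | j ≟ l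
... | yes refl | yes refl | _        | _        = contradiction refl k≢l
... | yes refl | no i≢l   | yes refl | _        = contradiction refl i≢j
... | yes refl | no i≢l   | no _     | yes refl = same
... | yes refl | no i≢l   | no _     | no j≢l   = meetˡˡ i≢l j≢l
... | no i≢k   | yes refl | yes refl | _        = swap
... | no i≢k   | yes refl | no j≢k   | _        = meetˡʳ i≢k j≢k
... | no i≢k   | no i≢l   | yes refl | yes refl = contradiction refl k≢l
... | no i≢k   | no i≢l   | yes refl | no j≢l   = meetʳˡ i≢l j≢l
... | no i≢k   | no i≢l   | no j≢k   | yes refl = meetʳʳ i≢k j≢k
... | no i≢k   | no i≢l   | no j≢k   | no j≢l   = apart i≢k i≢l j≢k j≢l

module Charts {A : Set} (E : A → A → Set) (E-sym : Symmetric E) (E-irrefl : ∀ u → ¬ E u u) where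

  E-≡-irrefl : ∀ {u v} → u ≡ v → ¬ E u v
  E-≡-irrefl refl = E-irrefl _

  -- A labelling of the neighbours of u by the 2-subsets of Fin n, witnessing
  -- that the local graph at u is T_n; nb i i carries no information.
  record Chart (n : ℕ) (u : A) : Set where
    field
      nb        : Fin n → Fin n → A
      nb-sym    : ∀ {i j} → i ≢ j → nb i j ≡ nb j i
      nb-adj    : ∀ {i j} → i ≢ j → E u (nb i j)
      nb-onto   : ∀ {v} → E u v → ∃₂ λ i j → i ≢ j × nb i j ≡ v
      meet-adj  : ∀ {i j k} → i ≢ j → i ≢ k → j ≢ k → E (nb i j) (nb i k)
      apart-¬adj : ∀ {i j k l} → i ≢ j → k ≢ l → i ≢ k → i ≢ l → j ≢ k → j ≢ l → ¬ E (nb i j) (nb k l)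
      apart-≢   : ∀ {i j k l} → i ≢ j → k ≢ l → i ≢ k → i ≢ l → j ≢ k → j ≢ l → nb i j ≢ nb k l

    meet-adjʳ : ∀ {i j k} → i ≢ k → j ≢ k → i ≢ j → E (nb i k) (nb j k)
    meet-adjʳ i≢k j≢k i≢j =
      subst₂ E (nb-sym (≢-sym i≢k)) (nb-sym (≢-sym j≢k)) (meet-adj (≢-sym i≢k) (≢-sym j≢k) i≢j)

    meet-adjˡʳ : ∀ {i j k} → i ≢ j → i ≢ k → j ≢ k → E (nb i j) (nb k i)
    meet-adjˡʳ i≢j i≢k j≢k = subst (E _) (nb-sym i≢k) (meet-adj i≢j i≢k j≢k)

    meet-adjʳˡ : ∀ {i j k} → i ≢ j → j ≢ k → i ≢ k → E (nb i j) (nb j k)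
    meet-adjʳˡ i≢j j≢k i≢k = E-sym (meet-adjˡʳ j≢k (≢-sym i≢j) (≢-sym i≢k))

    -- Meeting pairs label adjacent vertices, which differ by irreflexivity; only disjoint pairs
    -- need the field `apart-≢`.
    nb-injective : ∀ {i j k l} → i ≢ j → k ≢ l → nb i j ≡ nb k l → (i ≡ k × j ≡ l) ⊎ (i ≡ l × j ≡ k)
    nb-injective i≢j k≢l p with pairs i≢j k≢l
    ... | same           = inj₁ (refl , refl)
    ... | swap           = inj₂ (refl , refl)
    ... | meetˡˡ i≢l j≢l = contradiction (meet-adj i≢j i≢l j≢l) (E-≡-irrefl p)
    ... | meetˡʳ i≢k j≢k = contradiction (meet-adjˡʳ i≢j i≢k j≢k) (E-≡-irrefl p)
    ... | meetʳˡ i≢l j≢l = contradiction (meet-adjʳˡ i≢j j≢l i≢l) (E-≡-irrefl p)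
    ... | meetʳʳ i≢k j≢k = contradiction (meet-adjʳ i≢j (≢-sym j≢k) i≢k) (E-≡-irrefl p)
    ... | apart a b c d  = contradiction p (apart-≢ i≢j k≢l a b c d)

  open Chart

  relabel : ∀ {u} → Permutation′ n → Chart n u → Chart n u
  relabel {n} σ ch = record
    { nb         = λ i j → nb ch (σ ⟨$⟩ʳ i) (σ ⟨$⟩ʳ j)
    ; nb-sym     = nb-sym ch ∘ ≢σ
    ; nb-adj     = nb-adj ch ∘ ≢σ
    ; nb-onto    = onto
    ; meet-adj   = λ p q r → meet-adj ch (≢σ p) (≢σ q) (≢σ r)
    ; apart-¬adj = λ p q r s t v → apart-¬adj ch (≢σ p) (≢σ q) (≢σ r) (≢σ s) (≢σ t) (≢σ v)
    ; apart-≢    = λ p q r s t v → apart-≢ ch (≢σ p) (≢σ q) (≢σ r) (≢σ s) (≢σ t) (≢σ v)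
    }
    where
    ≢σ : ∀ {i j} → i ≢ j → σ ⟨$⟩ʳ i ≢ σ ⟨$⟩ʳ j
    ≢σ i≢j p = i≢j (trans (sym (P.inverseˡ σ)) (trans (cong (σ ⟨$⟩ˡ_) p) (P.inverseˡ σ)))
    onto : ∀ {v} → E _ v → ∃₂ λ i j → i ≢ j × nb ch (σ ⟨$⟩ʳ i) (σ ⟨$⟩ʳ j) ≡ v
    onto uv with nb-onto ch uv
    ... | i , j , i≢j , eq = σ ⟨$⟩ˡ i , σ ⟨$⟩ˡ j ,
      (λ p → i≢j (trans (sym (P.inverseʳ σ)) (trans (cong (σ ⟨$⟩ʳ_) p) (P.inverseʳ σ)))) ,
      trans (cong₂ (nb ch) (P.inverseʳ σ) (P.inverseʳ σ)) eq

  -- If `c l` is the image of y + e_l for an odd vector y and `u` is `c i`, then `w` is the image of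
  -- y + e_i + e_j + e_k. It is described by its relations to the clique alone, so that it can be
  -- recognised in several charts.
  record Apex {n} (u : A) (c : Fin n → A) (i j k : Fin n) (w : A) : Set where
    field
      base  : E u w
      left  : E (c j) w
      right : E (c k) w
      ¬adj  : ∀ {l} → l ≢ i → l ≢ j → l ≢ k → ¬ E (c l) w
      ≢-far : ∀ {l} → l ≢ i → l ≢ j → l ≢ k → c l ≢ w

  open Apex

  -- The chart sees the clique as the star of the pairs through `i`; the place of `c i` is taken by
  -- `u` itself.
  Extends : ∀ {u} → Chart n u → Fin n → (Fin n → A) → Set
  Extends ch i c = ∀ {k} → i ≢ k → nb ch i k ≡ c k

  nb-apex : ∀ {u} (ch : Chart n u) {c i j k} → Extends ch i c → i ≢ j → i ≢ k → j ≢ k →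
    Apex u c i j k (nb ch j k)
  nb-apex ch ext i≢j i≢k j≢k = record
    { base  = nb-adj ch j≢k
    ; left  = subst (λ v → E v _) (ext i≢j) (meet-adjʳˡ ch i≢j j≢k i≢k)
    ; right = subst (λ v → E v _) (ext i≢k) (meet-adjʳ ch i≢k j≢k i≢j)
    ; ¬adj  = λ l≢i l≢j l≢k → subst (λ v → ¬ E v _) (ext (≢-sym l≢i))
        (apart-¬adj ch (≢-sym l≢i) j≢k i≢j i≢k l≢j l≢k)
    ; ≢-far = λ l≢i l≢j l≢k → subst (_≢ _) (ext (≢-sym l≢i))
        (apart-≢ ch (≢-sym l≢i) j≢k i≢j i≢k l≢j l≢k)
    }

  apex-off-pencil : ∀ {u} (ch : Chart n u) {c i j k b w} → Extends ch i c →
    Apex u c i j k w → i ≢ b → nb ch i b ≢ w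
  apex-off-pencil ch {j = j} {k} {b} ext ap i≢b eq with b ≟ j | b ≟ k
  ... | yes refl | _        = E-≡-irrefl (trans (sym (ext i≢b)) eq) (left ap)
  ... | no _     | yes refl = E-≡-irrefl (trans (sym (ext i≢b)) eq) (right ap)
  ... | no b≢j   | no b≢k   = ≢-far ap (≢-sym i≢b) b≢j b≢k (trans (sym (ext i≢b)) eq)

  -- Read `w` as a pair of labels. It avoids `i`, since an apex differs from every vertex of the
  -- star. Each of its two labels x then gives a star vertex `nb ch i x` adjacent to `w`, and `¬adj`
  -- leaves only `j` and `k` for x.
  apex-unique : ∀ {u} (ch : Chart n u) {c i j k w} → Extends ch i c → j ≢ k →
    Apex u c i j k w → w ≡ nb ch j k
  apex-unique ch {c} {i} {j} {k} {w} ext j≢k ap with nb-onto ch (base ap)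
  ... | a , b , a≢b , refl with i ≟ a | i ≟ b
  ...   | yes refl | yes refl = contradiction refl a≢b
  ...   | yes refl | no i≢b   = contradiction refl (apex-off-pencil ch ext ap i≢b)
  ...   | no i≢a   | yes refl = contradiction (nb-sym ch i≢a) (apex-off-pencil ch ext ap i≢a)
  ...   | no i≢a   | no i≢b   =
    go (endpoint i≢a (meet-adjʳˡ ch i≢a a≢b i≢b)) (endpoint i≢b (meet-adjʳ ch i≢b a≢b i≢a))
    where
    endpoint : ∀ {x} → i ≢ x → E (nb ch i x) w → x ≡ j ⊎ x ≡ k
    endpoint {x} i≢x adj with x ≟ j | x ≟ k
    ... | yes x≡j | _       = inj₁ x≡j
    ... | no _    | yes x≡k = inj₂ x≡k
    ... | no x≢j  | no x≢k  = contradiction (subst (λ v → E v w) (ext i≢x) adj) (¬adj ap (≢-sym i≢x) x≢j x≢k)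
    go : a ≡ j ⊎ a ≡ k → b ≡ j ⊎ b ≡ k → nb ch a b ≡ nb ch j k
    go (inj₁ refl) (inj₁ refl) = contradiction refl a≢b
    go (inj₁ refl) (inj₂ refl) = refl
    go (inj₂ refl) (inj₁ refl) = nb-sym ch a≢b
    go (inj₂ refl) (inj₂ refl) = contradiction refl a≢b

  -- Off the star every vertex of one chart is an apex over the star, and `apex-unique` finds it in
  -- the other. In other words, an automorphism of T_n fixing a star pointwise is the identity.
  pencil-determines-chart : ∀ {u v} → u ≡ v → (ch : Chart n u) (ch′ : Chart n v) → ∀ i →
    Extends ch i (nb ch′ i) → ∀ {j k} → j ≢ k → nb ch j k ≡ nb ch′ j k
  pencil-determines-chart refl ch ch′ i ext {j} {k} j≢k with i ≟ j | i ≟ k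
  ... | yes refl | _        = ext j≢k
  ... | no i≢j   | yes refl = trans (nb-sym ch j≢k) (trans (ext i≢j) (nb-sym ch′ i≢j))
  ... | no i≢j   | no i≢k   = sym (apex-unique ch ext j≢k (nb-apex ch′ (λ _ → refl) i≢j i≢k j≢k))

  Clique : (Fin n → A) → Set
  Clique c = ∀ {i j} → i ≢ j → E (c i) (c j)

  -- The centre `a` of the star is any label of the chart; `pencil⇒permutation` renames it to `i`.
  Pencil : ∀ {u} → Chart n u → Fin n → (Fin n → A) → Set
  Pencil ch i c = ∃ λ a → ∀ {k} → i ≢ k → ∃ λ z → a ≢ z × nb ch a z ≡ c k

  -- Send `i` to the centre and every other label to the free end of its pair. Ends are distinct
  -- because adjacent vertices are, so this is a permutation.
  pencil⇒permutation : ∀ {u} (ch : Chart n u) {i c} → Clique c → Pencil ch i c →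
    ∃ λ σ → Extends (relabel σ ch) i c
  pencil⇒permutation {n} ch {i} {c} clique (a , onto) =
    proj₁ σ≡s , λ i≢k → trans (cong₂ (nb ch) (trans (proj₂ σ≡s i) s-i) (proj₂ σ≡s _)) (s-onto i≢k)
    where
    s : Fin n → Fin n
    s k with i ≟ k
    ... | yes _  = a
    ... | no i≢k = proj₁ (onto i≢k)
    s-i : s i ≡ a
    s-i with i ≟ i
    ... | yes _  = refl
    ... | no i≢i = contradiction refl i≢i
    s-onto : ∀ {k} → i ≢ k → nb ch a (s k) ≡ c k
    s-onto {k} i≢k with i ≟ k
    ... | yes i≡k = contradiction i≡k i≢k
    ... | no i≢k′ = proj₂ (proj₂ (onto i≢k′))
    s-injective : ∀ {k l} → s k ≡ s l → k ≡ l
    s-injective {k} {l} p with i ≟ k | i ≟ l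
    ... | yes refl | yes refl = refl
    ... | yes _    | no i≢l   = contradiction p (proj₁ (proj₂ (onto i≢l)))
    ... | no i≢k   | yes _    = contradiction (sym p) (proj₁ (proj₂ (onto i≢k)))
    ... | no i≢k   | no i≢l with k ≟ l
    ...   | yes k≡l = k≡l
    ...   | no k≢l  = contradiction (clique k≢l)
      (E-≡-irrefl (trans (sym (proj₂ (proj₂ (onto i≢k)))) (trans (cong (nb ch a) p) (proj₂ (proj₂ (onto i≢l))))))
    σ≡s : ∃ λ (σ : Permutation′ n) → ∀ k → σ ⟨$⟩ʳ k ≡ s k
    σ≡s = injective⇒permutation s s-injective

  adjacent-pair : ∀ {u v w} (ch : Chart n u) → E u v → E u w → E v w →
    ∃ λ a → ∃₂ λ x y → a ≢ x × a ≢ y × x ≢ y × nb ch a x ≡ v × nb ch a y ≡ w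
  adjacent-pair ch uv uw vw with nb-onto ch uv | nb-onto ch uw
  ... | i , j , i≢j , refl | k , l , k≢l , refl with pairs i≢j k≢l
  ...   | same           = contradiction vw (E-irrefl _)
  ...   | swap           = contradiction vw (E-≡-irrefl (nb-sym ch i≢j))
  ...   | meetˡˡ i≢l j≢l = i , j , l , i≢j , i≢l , j≢l , refl , refl
  ...   | meetˡʳ i≢k j≢k = i , j , k , i≢j , i≢k , j≢k , refl , nb-sym ch i≢k
  ...   | meetʳˡ i≢l j≢l = j , i , l , ≢-sym i≢j , j≢l , i≢l , nb-sym ch (≢-sym i≢j) , refl
  ...   | meetʳʳ i≢k j≢k = j , i , k , ≢-sym i≢j , j≢k , i≢k , nb-sym ch (≢-sym i≢j) , nb-sym ch j≢k
  ...   | apart p q r s  = contradiction vw (apart-¬adj ch i≢j k≢l p q r s)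

  -- A pair that misses `a` but meets both `ax` and `ay` must contain `x` and `y`. These are the two
  -- ways to enlarge an edge of T_n to a clique: a star or a triangle.
  common-nb : ∀ {u w} (ch : Chart n u) {a x y} → a ≢ x → a ≢ y → x ≢ y →
    E u w → E (nb ch a x) w → E (nb ch a y) w → (∃ λ z → a ≢ z × nb ch a z ≡ w) ⊎ nb ch x y ≡ w
  common-nb ch {a} {x} {y} a≢x a≢y x≢y uw xw yw with nb-onto ch uw
  ... | p , q , p≢q , refl with a ≟ p | a ≟ q
  ...   | yes refl | _        = inj₁ (q , p≢q , refl)
  ...   | no a≢p   | yes refl = inj₁ (p , a≢p , nb-sym ch a≢p)
  ...   | no a≢p   | no a≢q   = inj₂ (go (endpoint a≢x xw) (endpoint a≢y yw))
    where
    endpoint : ∀ {z} → a ≢ z → E (nb ch a z) (nb ch p q) → z ≡ p ⊎ z ≡ q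
    endpoint {z} a≢z adj with z ≟ p | z ≟ q
    ... | yes z≡p | _       = inj₁ z≡p
    ... | no _    | yes z≡q = inj₂ z≡q
    ... | no z≢p  | no z≢q  = contradiction adj (apart-¬adj ch a≢z p≢q a≢p a≢q z≢p z≢q)
    go : x ≡ p ⊎ x ≡ q → y ≡ p ⊎ y ≡ q → nb ch x y ≡ nb ch p q
    go (inj₁ refl) (inj₁ refl) = contradiction refl x≢y
    go (inj₁ refl) (inj₂ refl) = refl
    go (inj₂ refl) (inj₁ refl) = nb-sym ch x≢y
    go (inj₂ refl) (inj₂ refl) = contradiction refl x≢y

  -- The other members of the clique are at least four pairwise adjacent pairs at `c i`, too many
  -- for a triangle, so they form a star.
  clique⇒pencil : 5 ≤ n → ∀ {c : Fin n → A} {i} → Clique c → (ch : Chart n (c i)) → Pencil ch i c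
  clique⇒pencil 5≤n {c} {i} clique ch
    with fresh (i ∷ []) (ℕ.≤-trans (s≤s (s≤s z≤n)) 5≤n)
  ... | j , j≢i ∷ []
    with fresh (i ∷ j ∷ []) (ℕ.≤-trans (s≤s (s≤s (s≤s z≤n))) 5≤n)
  ... | k , k≢i ∷ k≢j ∷ []
    with adjacent-pair ch (clique (≢-sym j≢i)) (clique (≢-sym k≢i)) (clique (≢-sym k≢j))
  ... | a , x , y , a≢x , a≢y , x≢y , ax≡cj , ay≡ck = a , onto
    where
    common : ∀ {l} → i ≢ l → l ≢ j → l ≢ k → (∃ λ z → a ≢ z × nb ch a z ≡ c l) ⊎ nb ch x y ≡ c l
    common i≢l l≢j l≢k = common-nb ch a≢x a≢y x≢y (clique i≢l)
      (subst (λ v → E v _) (sym ax≡cj) (clique (≢-sym l≢j)))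
      (subst (λ v → E v _) (sym ay≡ck) (clique (≢-sym l≢k)))
    ¬triangle : ∀ {l} → i ≢ l → l ≢ j → l ≢ k → nb ch x y ≢ c l
    -- A further member `c r` would be a pair `az` with `z` different from `x` and `y`, which is
    -- disjoint from `xy`.
    ¬triangle {l} i≢l l≢j l≢k xy≡cl with fresh (i ∷ j ∷ k ∷ l ∷ []) 5≤n
    ... | r , r≢i ∷ r≢j ∷ r≢k ∷ r≢l ∷ [] with common (≢-sym r≢i) r≢j r≢k
    ...   | inj₂ xy≡cr = E-≡-irrefl (trans (sym xy≡cl) xy≡cr) (clique (≢-sym r≢l))
    ...   | inj₁ (z , a≢z , az≡cr) with z ≟ x | z ≟ y
    ...     | yes refl | _        = E-≡-irrefl (trans (sym az≡cr) ax≡cj) (clique r≢j)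
    ...     | no _     | yes refl = E-≡-irrefl (trans (sym az≡cr) ay≡ck) (clique r≢k)
    ...     | no z≢x   | no z≢y   = apart-¬adj ch a≢z x≢y a≢x a≢y z≢x z≢y
      (subst₂ E (sym az≡cr) (sym xy≡cl) (clique r≢l))
    onto : ∀ {l} → i ≢ l → ∃ λ z → a ≢ z × nb ch a z ≡ c l
    onto {l} i≢l with l ≟ j | l ≟ k
    ... | yes refl | _        = x , a≢x , ax≡cj
    ... | no _     | yes refl = y , a≢y , ay≡ck
    ... | no l≢j   | no l≢k with common i≢l l≢j l≢k
    ...   | inj₁ found = found
    ...   | inj₂ xy≡cl = contradiction xy≡cl (¬triangle i≢l l≢j l≢k)

  complement-nb : ∀ {u} → Chart 4 u → Fin 4 → Fin 4 → A
  complement-nb ch a b = nb ch (proj₁ c) (proj₁ (fresh (a ∷ b ∷ proj₁ c ∷ []) (s≤s (s≤s (s≤s (s≤s z≤n))))))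
    where
    c : ∃ λ c → All (c ≢_) (a ∷ b ∷ [])
    c = fresh (a ∷ b ∷ []) (s≤s (s≤s (s≤s z≤n)))

  -- The order in which `fresh` returns the two remaining labels is unknown, but `nb-sym` makes it
  -- irrelevant.
  complement-nb-≡ : ∀ {u} (ch : Chart 4 u) {a b c d} → Unique (a ∷ b ∷ c ∷ d ∷ []) →
    complement-nb ch a b ≡ nb ch c d
  complement-nb-≡ ch {a} {b} {c} {d} uniq@(_ ∷ _ ∷ (c≢d ∷ []) ∷ _) with fresh (a ∷ b ∷ []) (s≤s (s≤s (s≤s z≤n)))
  ... | c′ , c′≢a ∷ c′≢b ∷ [] with fresh (a ∷ b ∷ c′ ∷ []) (s≤s (s≤s (s≤s (s≤s z≤n))))
  ... | d′ , d′≢a ∷ d′≢b ∷ d′≢c′ ∷ [] = go (remaining c′≢a c′≢b) (remaining d′≢a d′≢b)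
    where
    remaining : ∀ {j} → j ≢ a → j ≢ b → j ≡ c ⊎ j ≡ d
    remaining {j} j≢a j≢b with exhaust uniq ℕ.≤-refl j
    ... | here j≡a                       = contradiction j≡a j≢a
    ... | there (here j≡b)               = contradiction j≡b j≢b
    ... | there (there (here j≡c))         = inj₁ j≡c
    ... | there (there (there (here j≡d))) = inj₂ j≡d
    go : c′ ≡ c ⊎ c′ ≡ d → d′ ≡ c ⊎ d′ ≡ d → nb ch c′ d′ ≡ nb ch c d
    go (inj₁ refl) (inj₁ refl) = contradiction refl d′≢c′
    go (inj₁ refl) (inj₂ refl) = refl
    go (inj₂ refl) (inj₁ refl) = nb-sym ch (≢-sym c≢d)
    go (inj₂ refl) (inj₂ refl) = contradiction refl d′≢c′

  -- T₄ is the octahedron; complementation of 2-subsets is an automorphism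
  -- exchanging its two kinds of triangles.
  complement : ∀ {u} → Chart 4 u → Chart 4 u
  complement ch = record
    { nb         = complement-nb ch
    ; nb-sym     = λ i≢j → let k , l , uniq = extend i≢j in
        trans (complement-nb-≡ ch uniq) (sym (complement-nb-≡ ch (swap₁₂ uniq)))
    ; nb-adj     = λ i≢j → let k , l , uniq = extend i≢j in
        subst (E _) (sym (complement-nb-≡ ch uniq)) (nb-adj ch (last≢ uniq))
    ; nb-onto    = λ uv → let k , l , k≢l , eq = nb-onto ch uv ; i , j , uniq = extend k≢l in
        i , j , last≢ uniq , trans (complement-nb-≡ ch (swap-pairs uniq)) eq
    ; meet-adj   = λ i≢j i≢k j≢k → let l , l≢ = fresh (_ ∷ _ ∷ _ ∷ []) (s≤s (s≤s (s≤s (s≤s z≤n)))) in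
        meet i≢j i≢k j≢k l≢
    ; apart-¬adj = λ i≢j k≢l i≢k i≢l j≢k j≢l → subst₂ (λ v w → ¬ E v w)
        (sym (complement-nb-≡ ch (unique₄ i≢j i≢k i≢l j≢k j≢l k≢l)))
        (sym (complement-nb-≡ ch (swap-pairs (unique₄ i≢j i≢k i≢l j≢k j≢l k≢l))))
        (apart-¬adj ch k≢l i≢j (≢-sym i≢k) (≢-sym j≢k) (≢-sym i≢l) (≢-sym j≢l))
    ; apart-≢    = λ i≢j k≢l i≢k i≢l j≢k j≢l → subst₂ _≢_
        (sym (complement-nb-≡ ch (unique₄ i≢j i≢k i≢l j≢k j≢l k≢l)))
        (sym (complement-nb-≡ ch (swap-pairs (unique₄ i≢j i≢k i≢l j≢k j≢l k≢l))))
        (apart-≢ ch k≢l i≢j (≢-sym i≢k) (≢-sym j≢k) (≢-sym i≢l) (≢-sym j≢l))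
    }
    where
    extend : ∀ {i j : Fin 4} → i ≢ j → ∃₂ λ k l → Unique (i ∷ j ∷ k ∷ l ∷ [])
    extend {i} {j} i≢j with fresh (i ∷ j ∷ []) (s≤s (s≤s (s≤s z≤n)))
    ... | k , k≢i ∷ k≢j ∷ [] with fresh (i ∷ j ∷ k ∷ []) (s≤s (s≤s (s≤s (s≤s z≤n))))
    ... | l , l≢i ∷ l≢j ∷ l≢k ∷ [] =
      k , l , unique₄ i≢j (≢-sym k≢i) (≢-sym l≢i) (≢-sym k≢j) (≢-sym l≢j) (≢-sym l≢k)
    swap₁₂ : ∀ {i j k l : Fin 4} → Unique (i ∷ j ∷ k ∷ l ∷ []) → Unique (j ∷ i ∷ k ∷ l ∷ [])
    swap₁₂ ((i≢j ∷ i∉) ∷ j∉ ∷ uniq) = (≢-sym i≢j ∷ j∉) ∷ i∉ ∷ uniq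
    swap-pairs : ∀ {i j k l : Fin 4} → Unique (i ∷ j ∷ k ∷ l ∷ []) → Unique (k ∷ l ∷ i ∷ j ∷ [])
    swap-pairs ((i≢j ∷ i≢k ∷ i≢l ∷ []) ∷ (j≢k ∷ j≢l ∷ []) ∷ (k≢l ∷ []) ∷ [] ∷ []) =
      unique₄ k≢l (≢-sym i≢k) (≢-sym j≢k) (≢-sym i≢l) (≢-sym j≢l) i≢j
    last≢ : ∀ {i j k l : Fin 4} → Unique (i ∷ j ∷ k ∷ l ∷ []) → k ≢ l
    last≢ (_ ∷ _ ∷ (k≢l ∷ []) ∷ _) = k≢l
    meet : ∀ {i j k l} → i ≢ j → i ≢ k → j ≢ k → All (l ≢_) (i ∷ j ∷ k ∷ []) →
      E (complement-nb ch i j) (complement-nb ch i k)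
    meet i≢j i≢k j≢k (l≢i ∷ l≢j ∷ l≢k ∷ []) = subst₂ E
      (sym (complement-nb-≡ ch (unique₄ i≢j (≢-sym l≢i) i≢k (≢-sym l≢j) j≢k l≢k)))
      (sym (complement-nb-≡ ch (unique₄ i≢k (≢-sym l≢i) i≢j (≢-sym l≢k) (≢-sym j≢k) l≢j)))
      (meet-adj ch l≢k l≢j (≢-sym j≢k))

  -- For n = 2 and n = 3 there are at most two further clique vertices, and these always lie in a
  -- star. For n = 4 the three further vertices may form a triangle, which forces a change of chart.
  clique⇒pencil-chart : 2 ≤ n → ∀ {c : Fin n → A} {i} → Clique c → Chart n (c i) →
    ∃ λ (ch : Chart n (c i)) → Pencil ch i c
  clique⇒pencil-chart {suc zero} (s≤s ())
  clique⇒pencil-chart {suc (suc zero)} _ {c} {i} clique ch with fresh (i ∷ []) (s≤s (s≤s z≤n))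
  ... | j , j≢i ∷ [] with nb-onto ch (clique (≢-sym j≢i))
  ... | a , x , a≢x , ax≡cj = ch , a , onto
    where
    onto : ∀ {l} → i ≢ l → ∃ λ z → a ≢ z × nb ch a z ≡ c l
    onto {l} i≢l with exhaust ((j≢i ∷ []) ∷ [] ∷ []) ℕ.≤-refl l
    ... | here refl         = x , a≢x , ax≡cj
    ... | there (here refl) = contradiction refl i≢l
  clique⇒pencil-chart {suc (suc (suc zero))} _ {c} {i} clique ch with fresh (i ∷ []) (s≤s (s≤s z≤n))
  ... | j , j≢i ∷ [] with fresh (i ∷ j ∷ []) (s≤s (s≤s (s≤s z≤n)))
  ... | k , k≢i ∷ k≢j ∷ []
    with adjacent-pair ch (clique (≢-sym j≢i)) (clique (≢-sym k≢i)) (clique (≢-sym k≢j))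
  ... | a , x , y , a≢x , a≢y , x≢y , ax≡cj , ay≡ck = ch , a , onto
    where
    onto : ∀ {l} → i ≢ l → ∃ λ z → a ≢ z × nb ch a z ≡ c l
    onto {l} i≢l with exhaust ((k≢i ∷ k≢j ∷ []) ∷ (≢-sym j≢i ∷ []) ∷ [] ∷ []) ℕ.≤-refl l
    ... | here refl                 = y , a≢y , ay≡ck
    ... | there (here refl)         = contradiction refl i≢l
    ... | there (there (here refl)) = x , a≢x , ax≡cj
  clique⇒pencil-chart {suc (suc (suc (suc zero)))} _ {c} {i} clique ch with fresh (i ∷ []) (s≤s (s≤s z≤n))
  ... | j , j≢i ∷ [] with fresh (i ∷ j ∷ []) (s≤s (s≤s (s≤s z≤n)))
  ... | k , k≢i ∷ k≢j ∷ [] with fresh (i ∷ j ∷ k ∷ []) (s≤s (s≤s (s≤s (s≤s z≤n))))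
  ... | l , l≢i ∷ l≢j ∷ l≢k ∷ []
    with adjacent-pair ch (clique (≢-sym j≢i)) (clique (≢-sym k≢i)) (clique (≢-sym k≢j))
  ... | a , x , y , a≢x , a≢y , x≢y , ax≡cj , ay≡ck
    with common-nb ch a≢x a≢y x≢y (clique (≢-sym l≢i))
      (subst (λ v → E v _) (sym ax≡cj) (clique (≢-sym l≢j)))
      (subst (λ v → E v _) (sym ay≡ck) (clique (≢-sym l≢k)))
  ... | inj₁ (z , a≢z , az≡cl) = ch , a , onto
    where
    onto : ∀ {r} → i ≢ r → ∃ λ z → a ≢ z × nb ch a z ≡ c r
    onto {r} i≢r with exhaust (unique₄ l≢i l≢j l≢k (≢-sym j≢i) (≢-sym k≢i) (≢-sym k≢j)) ℕ.≤-refl r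
    ... | here refl                         = z , a≢z , az≡cl
    ... | there (here refl)                 = contradiction refl i≢r
    ... | there (there (here refl))         = x , a≢x , ax≡cj
    ... | there (there (there (here refl))) = y , a≢y , ay≡ck
  -- The clique is the triangle on `a`, `x`, `y`; the complements of its pairs are the pairs through
  -- the fourth label `z`.
  ... | inj₂ xy≡cl with fresh (a ∷ x ∷ y ∷ []) (s≤s (s≤s (s≤s (s≤s z≤n))))
  ...   | z , z≢a ∷ z≢x ∷ z≢y ∷ [] = complement ch , z , onto
    where
    onto : ∀ {r} → i ≢ r → ∃ λ t → z ≢ t × complement-nb ch z t ≡ c r
    onto {r} i≢r with exhaust (unique₄ l≢i l≢j l≢k (≢-sym j≢i) (≢-sym k≢i) (≢-sym k≢j)) ℕ.≤-refl r
    ... | here refl                         = a , z≢a , trans (complement-nb-≡ ch (unique₄ z≢a z≢x z≢y a≢x a≢y x≢y)) xy≡cl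
    ... | there (here refl)                 = contradiction refl i≢r
    ... | there (there (here refl))         = y , z≢y , trans (complement-nb-≡ ch (unique₄ z≢y z≢a z≢x (≢-sym a≢y) (≢-sym x≢y) a≢x)) ax≡cj
    ... | there (there (there (here refl))) = x , z≢x , trans (complement-nb-≡ ch (unique₄ z≢x z≢a z≢y (≢-sym a≢x) x≢y a≢y)) ay≡ck
  clique⇒pencil-chart {suc (suc (suc (suc (suc n))))} _ clique ch =
    ch , clique⇒pencil (s≤s (s≤s (s≤s (s≤s (s≤s z≤n))))) clique ch

  clique-chart : 2 ≤ n → ∀ {c : Fin n → A} {i} → Clique c → Chart n (c i) →
    ∃ λ (ch : Chart n (c i)) → Extends ch i c
  clique-chart 2≤n clique ch with clique⇒pencil-chart 2≤n clique ch
  ... | ch′ , pencil with pencil⇒permutation ch′ clique pencil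
  ...   | σ , ext = relabel σ ch′ , ext

  -- If `u` is the image of an even vector x, these are the images of the neighbours of x + e_0,
  -- labelled by the coordinate in which they differ from it.
  chart-clique : ∀ {u} → Chart (suc n) u → Fin (suc n) → A
  chart-clique {u = u} ch zero    = u
  chart-clique         ch (suc k) = nb ch zero (suc k)

  chart-clique-clique : ∀ {u} (ch : Chart (suc n) u) → Clique (chart-clique ch)
  chart-clique-clique ch {zero}  {zero}  0≢0 = contradiction refl 0≢0
  chart-clique-clique ch {zero}  {suc j} _   = nb-adj ch (λ ())
  chart-clique-clique ch {suc i} {zero}  _   = E-sym (nb-adj ch (λ ()))
  chart-clique-clique ch {suc i} {suc j} i≢j = meet-adj ch (λ ()) (λ ()) i≢j

  chart-clique-extends : ∀ {u} (ch : Chart (suc n) u) → Extends ch zero (chart-clique ch)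
  chart-clique-extends ch {zero}  0≢0 = contradiction refl 0≢0
  chart-clique-extends ch {suc k} _   = refl

  -- Aut(T_n) = S_n for n ≥ 5.
  charts-permuted : 5 ≤ n → ∀ {u v} → u ≡ v → (ch : Chart n u) (ch′ : Chart n v) →
    ∃ λ (σ : Permutation′ n) → ∀ {i j} → i ≢ j → nb ch i j ≡ nb (relabel σ ch′) i j
  charts-permuted {suc n} 5≤n refl ch ch′ with pencil⇒permutation ch′ (chart-clique-clique ch)
    (clique⇒pencil 5≤n (chart-clique-clique ch) ch′)
  ... | σ , ext = σ , pencil-determines-chart refl ch (relabel σ ch′) zero
    (λ 0≢k → trans (chart-clique-extends ch 0≢k) (sym (ext 0≢k)))

-- Coverings by a halved cube

-- Only the values of q at the vectors of parity b matter.
record Cover {A : Set} (E : A → A → Set) (n : ℕ) (b : Bool) : Set where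
  field
    q        : Vtx n → A
    near     : ∀ {x i j} → parity x ≡ b → i ≢ j → E (q x) (q (flip i (flip j x)))
    far-¬adj : ∀ {x i j k l} → parity x ≡ b → Unique (i ∷ j ∷ k ∷ l ∷ []) →
               ¬ E (q x) (q (flip i (flip j (flip k (flip l x)))))
    far-≢    : ∀ {x i j k l} → parity x ≡ b → Unique (i ∷ j ∷ k ∷ l ∷ []) →
               q x ≢ q (flip i (flip j (flip k (flip l x))))
    lift     : ∀ {x v} → parity x ≡ b → E (q x) v → ∃₂ λ i j → i ≢ j × q (flip i (flip j x)) ≡ v
    onto     : ∀ v → ∃ λ x → parity x ≡ b × q x ≡ v

-- Moving a labelled clique

module Steps {A : Set} (E : A → A → Set) (E-sym : Symmetric E) (E-irrefl : ∀ u → ¬ E u u) {n : ℕ} (2≤n : 2 ≤ n) (charts : ∀ u → Charts.Chart E E-sym E-irrefl n u) where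

  open Charts E E-sym E-irrefl
  open Chart
  open Apex

  -- With the base at `c i` the conditions are symmetric in `i`, `j`, `k`; the two swaps let one
  -- apex be read in the chart at any of these three clique vertices.
  Apexᶜ : (Fin n → A) → (i j k : Fin n) → A → Set
  Apexᶜ c i j k w = Apex (c i) c i j k w

  apex-swapʳ : ∀ {c i j k w} → Apexᶜ c i j k w → Apexᶜ c i k j w
  apex-swapʳ ap = record
    { base = base ap ; left = right ap ; right = left ap
    ; ¬adj = λ p q r → ¬adj ap p r q ; ≢-far = λ p q r → ≢-far ap p r q }

  apex-swapˡ : ∀ {c i j k w} → Apexᶜ c i j k w → Apexᶜ c j i k w
  apex-swapˡ ap = record
    { base = left ap ; left = base ap ; right = right ap
    ; ¬adj = λ p q r → ¬adj ap q p r ; ≢-far = λ p q r → ≢-far ap q p r }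

  module _ {c : Fin n → A} (clique : Clique c) where

    private
      chart : ∀ i → ∃ λ (ch : Chart n (c i)) → Extends ch i c
      chart i = clique-chart 2≤n clique (charts (c i))

    apex-exists : ∀ {i j k} → i ≢ j → i ≢ k → j ≢ k → ∃ (Apexᶜ c i j k)
    apex-exists {i} i≢j i≢k j≢k = let ch , ext = chart i in _ , nb-apex ch ext i≢j i≢k j≢k

    apexes-equal : ∀ {i j k v w} → j ≢ k → Apexᶜ c i j k v → Apexᶜ c i j k w → v ≡ w
    apexes-equal {i} j≢k ap ap′ = let ch , ext = chart i in
      trans (apex-unique ch ext j≢k ap) (sym (apex-unique ch ext j≢k ap′))

    -- In the chart at `c i` the two apexes are the pairs `jk` and `jl`; `apexes-apart` reads
    -- disjoint pairs in the same way.
    apexes-meet : ∀ {i j k l v w} → j ≢ k → j ≢ l → k ≢ l →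
      Apexᶜ c i j k v → Apexᶜ c i j l w → E v w
    apexes-meet {i} j≢k j≢l k≢l ap ap′ = let ch , ext = chart i in
      subst₂ E (sym (apex-unique ch ext j≢k ap)) (sym (apex-unique ch ext j≢l ap′)) (meet-adj ch j≢k j≢l k≢l)

    apexes-apart : ∀ {i j k l r v w} → Unique (j ∷ k ∷ l ∷ r ∷ []) →
      Apexᶜ c i j k v → Apexᶜ c i l r w → ¬ E v w × v ≢ w
    apexes-apart {i} ((j≢k ∷ j≢l ∷ j≢r ∷ []) ∷ (k≢l ∷ k≢r ∷ []) ∷ (l≢r ∷ []) ∷ _) ap ap′ =
      let ch , ext = chart i
          v≡ = sym (apex-unique ch ext j≢k ap)
          w≡ = sym (apex-unique ch ext l≢r ap′)
      in subst₂ (λ v w → ¬ E v w) v≡ w≡ (apart-¬adj ch j≢k l≢r j≢l j≢r k≢l k≢r) ,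
         subst₂ _≢_ v≡ w≡ (apart-≢ ch j≢k l≢r j≢l j≢r k≢l k≢r)

  -- If c labels the neighbours of an odd vertex y of the cube, with c k the
  -- image of y + e_k, then c′ labels the neighbours of y + e_i + e_j.
  record Step (i j : Fin n) (c c′ : Fin n → A) : Set where
    field
      atˡ : c′ i ≡ c j
      atʳ : c′ j ≡ c i
      tip : ∀ {k} → k ≢ i → k ≢ j → Apexᶜ c i j k (c′ k)

  open Step

  step-cong : ∀ {i j c d c′} → (∀ k → c k ≡ d k) → Step i j c c′ → Step i j d c′
  step-cong {i} {j} c≗d st = record
    { atˡ = trans (atˡ st) (c≗d j)
    ; atʳ = trans (atʳ st) (c≗d i)
    ; tip = λ k≢i k≢j → let ap = tip st k≢i k≢j in record
      { base  = subst (λ v → E v _) (c≗d _) (base ap)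
      ; left  = subst (λ v → E v _) (c≗d _) (left ap)
      ; right = subst (λ v → E v _) (c≗d _) (right ap)
      ; ¬adj  = λ p q r → subst (λ v → ¬ E v _) (c≗d _) (¬adj ap p q r)
      ; ≢-far = λ p q r → subst (_≢ _) (c≗d _) (≢-far ap p q r)
      }
    }

  step-exists : ∀ {i j c} → i ≢ j → Clique c → ∃ (Step i j c)
  step-exists {i} {j} {c} i≢j clique = c′ , record { atˡ = c′-i ; atʳ = c′-j ; tip = c′-tip }
    where
    c′ : Fin n → A
    c′ k with k ≟ i | k ≟ j
    ... | yes _  | _      = c j
    ... | no _   | yes _  = c i
    ... | no k≢i | no k≢j = proj₁ (apex-exists clique i≢j (≢-sym k≢i) (≢-sym k≢j))
    c′-i : c′ i ≡ c j
    c′-i with i ≟ i | i ≟ j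
    ... | yes _  | _ = refl
    ... | no i≢i | _ = contradiction refl i≢i
    c′-j : c′ j ≡ c i
    c′-j with j ≟ i | j ≟ j
    ... | yes j≡i | _      = contradiction (sym j≡i) i≢j
    ... | no _    | yes _  = refl
    ... | no _    | no j≢j = contradiction refl j≢j
    c′-tip : ∀ {k} → k ≢ i → k ≢ j → Apexᶜ c i j k (c′ k)
    c′-tip {k} k≢i k≢j with k ≟ i | k ≟ j
    ... | yes k≡i | _       = contradiction k≡i k≢i
    ... | no _    | yes k≡j = contradiction k≡j k≢j
    ... | no k≢i′ | no k≢j′ = proj₂ (apex-exists clique i≢j (≢-sym k≢i′) (≢-sym k≢j′))

  step-unique : ∀ {i j c c′ c″} → Clique c → Step i j c c′ → Step i j c c″ → ∀ k → c′ k ≡ c″ k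
  step-unique {i} {j} clique st st′ k with k ≟ i | k ≟ j
  ... | yes refl | _        = trans (atˡ st) (sym (atˡ st′))
  ... | no _     | yes refl = trans (atʳ st) (sym (atʳ st′))
  ... | no k≢i   | no k≢j   = apexes-equal clique (≢-sym k≢j) (tip st k≢i k≢j) (tip st′ k≢i k≢j)

  step-sym : ∀ {i j c c′} → Step i j c c′ → Step j i c c′
  step-sym st = record { atˡ = atʳ st ; atʳ = atˡ st ; tip = λ p q → apex-swapˡ (tip st q p) }

  -- The relations between `c k` and `c′ l` are the same seen from either clique, so each apex
  -- condition is one of the given conditions with the roles of `k` and `l` exchanged.
  step-back : ∀ {i j c c′} → Clique c → Step i j c c′ → Step i j c′ c
  step-back clique st = record
    { atˡ = sym (atʳ st)
    ; atʳ = sym (atˡ st)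
    ; tip = λ k≢i k≢j → record
      { base  = subst (λ v → E v _) (sym (atˡ st)) (clique (≢-sym k≢j))
      ; left  = subst (λ v → E v _) (sym (atʳ st)) (clique (≢-sym k≢i))
      ; right = E-sym (right (tip st k≢i k≢j))
      ; ¬adj  = λ l≢i l≢j l≢k → ¬adj (tip st l≢i l≢j) k≢i k≢j (≢-sym l≢k) ∘ E-sym
      ; ≢-far = λ l≢i l≢j l≢k → ≢-far (tip st l≢i l≢j) k≢i k≢j (≢-sym l≢k) ∘ sym
      }
    }

  step-clique : ∀ {i j c c′} → i ≢ j → Clique c → Step i j c c′ → Clique c′
  step-clique {i} {j} {c} {c′} i≢j clique st {k} {l} k≢l with k ≟ i | k ≟ j | l ≟ i | l ≟ j
  ... | yes refl | _        | yes refl | _        = contradiction refl k≢l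
  ... | yes refl | _        | no _     | yes refl = subst₂ E (sym (atˡ st)) (sym (atʳ st)) (clique (≢-sym i≢j))
  ... | yes refl | _        | no l≢i   | no l≢j   = subst (λ v → E v _) (sym (atˡ st)) (left (tip st l≢i l≢j))
  ... | no _     | yes refl | yes refl | _        = subst₂ E (sym (atʳ st)) (sym (atˡ st)) (clique i≢j)
  ... | no _     | yes refl | no _     | yes refl = contradiction refl k≢l
  ... | no _     | yes refl | no l≢i   | no l≢j   = subst (λ v → E v _) (sym (atʳ st)) (base (tip st l≢i l≢j))
  ... | no k≢i   | no k≢j   | yes refl | _        = E-sym (subst (λ v → E v _) (sym (atˡ st)) (left (tip st k≢i k≢j)))
  ... | no k≢i   | no k≢j   | no _     | yes refl = E-sym (subst (λ v → E v _) (sym (atʳ st)) (base (tip st k≢i k≢j)))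
  ... | no k≢i   | no k≢j   | no l≢i   | no l≢j   =
    apexes-meet clique (≢-sym k≢j) (≢-sym l≢j) k≢l (tip st k≢i k≢j) (tip st l≢i l≢j)

  -- This is (e_j + e_k) + (e_i + e_j) = e_i + e_k. Apexes of `c` have to be recognised as apexes of
  -- `c′`, mostly in the chart at `c k`: there `c′ r` is the pair `jr` for r other than j and k.
  step-trans : ∀ {i j k c c′ c″} → i ≢ j → i ≢ k → j ≢ k → Clique c →
    Step j k c c′ → Step i j c′ c″ → Step i k c c″
  step-trans {i} {j} {k} {c} {c′} {c″} i≢j i≢k j≢k clique st st′ = record
    { atˡ = trans (atˡ st′) (atˡ st)
    -- The vertex `c″ k` must return to `c i`, so `c i` is shown to be the apex of `c′` over `i`,
    -- `j`, `k`.
    ; atʳ = apexes-equal clique′ j≢k (tip st′ (≢-sym i≢k) (≢-sym j≢k)) record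
      { base  = E-sym (right tip-i)
      ; left  = subst (λ v → E v _) (sym (atˡ st)) (clique (≢-sym i≢k))
      ; right = subst (λ v → E v _) (sym (atʳ st)) (clique (≢-sym i≢j))
      ; ¬adj  = λ l≢i l≢j l≢k → ¬adj (tip st l≢j l≢k) i≢j i≢k (≢-sym l≢i) ∘ E-sym
      ; ≢-far = λ l≢i l≢j l≢k → ≢-far (tip st l≢j l≢k) i≢j i≢k (≢-sym l≢i) ∘ sym
      }
    ; tip = tip-ik
    }
    where
    clique′ : Clique c′
    clique′ = step-clique j≢k clique st
    tip-i : Apexᶜ c j k i (c′ i)
    tip-i = tip st i≢j i≢k
    tip-ik : ∀ {l} → l ≢ i → l ≢ k → Apexᶜ c i k l (c″ l)
    tip-ik {l} l≢i l≢k with l ≟ j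
    ... | yes refl = subst (Apexᶜ c i k j) (sym (atʳ st′)) (apex-swapʳ (apex-swapˡ (apex-swapʳ tip-i)))
    -- The apex `w` over `c` is the pair `il` in the chart at `c k`; once it is known to be an apex
    -- over `c′` as well, uniqueness identifies it with `c″ l`.
    ... | no l≢j with apex-exists clique i≢k (≢-sym l≢i) (≢-sym l≢k)
    ...   | w , ap = subst (Apexᶜ c i k l)
      (apexes-equal clique′ (≢-sym l≢j) ap′ (tip st′ l≢i l≢j)) ap
      where
      ap-k : Apexᶜ c k i l w
      ap-k = apex-swapˡ ap
      tip-k : ∀ {r} → r ≢ j → r ≢ k → Apexᶜ c k j r (c′ r)
      tip-k r≢j r≢k = apex-swapˡ (tip st r≢j r≢k)
      tip-ki : Apexᶜ c k i j (c′ i)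
      tip-ki = apex-swapʳ (tip-k i≢j i≢k)
      ¬adj′ : ∀ {r} → r ≢ i → r ≢ j → r ≢ l → ¬ E (c′ r) w × c′ r ≢ w
      ¬adj′ {r} r≢i r≢j r≢l with r ≟ k
      ... | yes refl = subst (λ v → ¬ E v w × v ≢ w) (sym (atʳ st))
        (¬adj ap (≢-sym i≢j) j≢k (≢-sym l≢j) , ≢-far ap (≢-sym i≢j) j≢k (≢-sym l≢j))
      ... | no r≢k = apexes-apart clique
        (unique₄ (≢-sym r≢j) (≢-sym i≢j) (≢-sym l≢j) r≢i r≢l (≢-sym l≢i)) (tip-k r≢j r≢k) ap-k
      ap′ : Apexᶜ c′ i j l w
      ap′ = record
        { base  = apexes-meet clique i≢j (≢-sym l≢i) (≢-sym l≢j) tip-ki ap-k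
        ; left  = subst (λ v → E v _) (sym (atˡ st)) (left ap)
        ; right = apexes-meet clique l≢j l≢i (≢-sym i≢j) (apex-swapʳ (tip-k l≢j l≢k)) (apex-swapʳ ap-k)
        ; ¬adj  = λ p q r → proj₁ (¬adj′ p q r)
        ; ≢-far = λ p q r → proj₂ (¬adj′ p q r)
        }

  step-congʳ : ∀ {i j c c′ d′} → (∀ k → c′ k ≡ d′ k) → Step i j c c′ → Step i j c d′
  step-congʳ c′≗d′ st = record
    { atˡ = trans (sym (c′≗d′ _)) (atˡ st)
    ; atʳ = trans (sym (c′≗d′ _)) (atʳ st)
    ; tip = λ p q → subst (Apexᶜ _ _ _ _) (c′≗d′ _) (tip st p q)
    }

  -- The `r`-th vertex moves from y + e_r to y + e_r + e_i + e_j, the neighbour `ij` in the chart at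
  -- `c r`, also when `r` is `i` or `j`.
  step-at : ∀ {i j r c c′} (ch : Chart n (c r)) → Extends ch r c → i ≢ j → Step i j c c′ →
    c′ r ≡ nb ch i j
  step-at {i} {j} {r} ch ext i≢j st with r ≟ i | r ≟ j
  ... | yes refl | _        = trans (atˡ st) (sym (ext i≢j))
  ... | no _     | yes refl = trans (atʳ st) (trans (sym (ext (≢-sym i≢j))) (nb-sym ch (≢-sym i≢j)))
  ... | no r≢i   | no r≢j   = apex-unique ch ext i≢j (apex-swapˡ (apex-swapʳ (tip st r≢i r≢j)))

-- Unfolding along commuting involutions

module Fold {F : Set} (_≋_ : F → F → Set) (≋-refl : ∀ {s} → s ≋ s) (≋-sym : ∀ {s t} → s ≋ t → t ≋ s) (≋-trans : ∀ {s t u} → s ≋ t → t ≋ u → s ≋ u) where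

  fold : (Fin n → F → F) → Vtx n → F → F
  fold g []          s = s
  fold g (false ∷ x) s = fold (g ∘ suc) x s
  fold g (true ∷ x)  s = g zero (fold (g ∘ suc) x s)

  fold-origin : (g : Fin n → F → F) (s : F) → fold g origin s ≡ s
  fold-origin {zero}  g s = refl
  fold-origin {suc n} g s = fold-origin (g ∘ suc) s

  -- Commuting involutions define an action of F_2^n. `fold` applies them in the order of the
  -- coordinates, so a new one is commuted inwards to its place and cancels there if it already
  -- occurs.
  fold-flip : (g : Fin n → F → F) → (∀ i {s t} → s ≋ t → g i s ≋ g i t) →
    (∀ i s → g i (g i s) ≋ s) → (∀ {i j} → i ≢ j → ∀ s → g i (g j s) ≋ g j (g i s)) →
    ∀ i x s → fold g (flip i x) s ≋ g i (fold g x s)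
  fold-flip g g-cong g-invol g-comm zero    (false ∷ x) s = ≋-refl
  fold-flip g g-cong g-invol g-comm zero    (true ∷ x)  s = ≋-sym (g-invol zero _)
  fold-flip g g-cong g-invol g-comm (suc i) (false ∷ x) s =
    fold-flip (g ∘ suc) (g-cong ∘ suc) (g-invol ∘ suc) (λ i≢j → g-comm (λ { refl → i≢j refl })) i x s
  fold-flip g g-cong g-invol g-comm (suc i) (true ∷ x)  s = ≋-trans
    (g-cong zero (fold-flip (g ∘ suc) (g-cong ∘ suc) (g-invol ∘ suc) (λ i≢j → g-comm (λ { refl → i≢j refl })) i x s))
    (g-comm (λ ()) _)

module Unfolding {A : Set} (E : A → A → Set) (E-sym : Symmetric E) (E-irrefl : ∀ u → ¬ E u u) {n : ℕ} (2≤n : 2 ≤ suc n) (charts : ∀ u → Charts.Chart E E-sym E-irrefl (suc n) u) (u₀ : A) (connected : (P : A → Set) → P u₀ → (∀ {u v} → E u v → P u → P v) → ∀ v → P v) where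

  open Charts E E-sym E-irrefl
  open Chart
  open Steps E E-sym E-irrefl 2≤n charts

  State : Set
  State = Σ (Fin (suc n) → A) Clique

  -- States are functions paired with proofs, so the relations between moves are stated pointwise on
  -- the functions.
  _≋_ : State → State → Set
  s ≋ t = ∀ k → proj₁ s k ≡ proj₁ t k

  open Fold _≋_ (λ _ → refl) (λ p k → sym (p k)) (λ p q k → trans (p k) (q k))

  -- The move by e_0 + e_{i+1}. These vectors form a basis of the even vectors, so involutivity and
  -- commutation are the only relations to verify.
  turn : Fin n → State → State
  turn i (c , clique) =
    let c′ , st = step-exists (λ ()) clique in c′ , step-clique {i = zero} {suc i} (λ ()) clique st

  turn-step : ∀ i s → Step zero (suc i) (proj₁ s) (proj₁ (turn i s))
  turn-step i (c , clique) = proj₂ (step-exists (λ ()) clique)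

  turn-cong : ∀ i {s t} → s ≋ t → turn i s ≋ turn i t
  turn-cong i {s} {t} s≋t = step-unique (proj₂ t) (step-cong s≋t (turn-step i s)) (turn-step i t)

  turn-involutive : ∀ i s → turn i (turn i s) ≋ s
  turn-involutive i s =
    step-unique (proj₂ (turn i s)) (turn-step i (turn i s)) (step-back (proj₂ s) (turn-step i s))

  turn-turn : ∀ {i j} → i ≢ j → ∀ s → Step (suc i) (suc j) (proj₁ s) (proj₁ (turn i (turn j s)))
  turn-turn {i} {j} i≢j s = step-trans (λ ()) (λ { refl → i≢j refl }) (λ ()) (proj₂ s)
    (turn-step j s) (step-sym (turn-step i (turn j s)))

  -- Both orders compose to the single step with labels `suc i` and `suc j`, which is symmetric in
  -- them and determined by the clique.
  turn-comm : ∀ {i j} → i ≢ j → ∀ s → turn i (turn j s) ≋ turn j (turn i s)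
  turn-comm i≢j s = step-unique (proj₂ s) (turn-turn i≢j s) (step-sym (turn-turn (≢-sym i≢j) s))

  -- Parity determines coordinate zero, so only the tail is folded. For even x the state labels the
  -- neighbours of x + e_0; its entry at zero is therefore the image of x.
  state : Vtx (suc n) → State
  state x = fold turn (tail x) (chart-clique (charts u₀) , chart-clique-clique (charts u₀))

  fold-turn-flip : ∀ i x s → fold turn (flip i x) s ≋ turn i (fold turn x s)
  fold-turn-flip = fold-flip turn turn-cong turn-involutive turn-comm

  state-step : ∀ {i j} → i ≢ j → ∀ x → Step i j (proj₁ (state x)) (proj₁ (state (flip i (flip j x))))
  state-step {zero}  {zero}  i≢j _       = contradiction refl i≢j
  state-step {zero}  {suc j} _   (b ∷ x) =
    step-congʳ (λ k → sym (fold-turn-flip j x _ k)) (turn-step j (state (b ∷ x)))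
  state-step {suc i} {zero}  _   (b ∷ x) =
    step-sym (step-congʳ (λ k → sym (fold-turn-flip i x _ k)) (turn-step i (state (b ∷ x))))
  state-step {suc i} {suc j} i≢j (b ∷ x) =
    step-congʳ (λ k → sym (trans (fold-turn-flip i (flip j x) _ k) (turn-cong i (fold-turn-flip j x _) k)))
      (turn-turn (λ { refl → i≢j refl }) (state (b ∷ x)))

  image : Vtx (suc n) → A
  image x = proj₁ (state x) zero

  state-chart : ∀ x → ∃ λ (ch : Chart (suc n) (image x)) → Extends ch zero (proj₁ (state x))
  state-chart x = clique-chart 2≤n (proj₂ (state x)) (charts _)

  image-flip² : ∀ {i j} → i ≢ j → ∀ x → image (flip i (flip j x)) ≡ nb (proj₁ (state-chart x)) i j
  image-flip² i≢j x = step-at (proj₁ (state-chart x)) (proj₂ (state-chart x)) i≢j (state-step i≢j x)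

  -- The step back sees `x` as the neighbour `ij` of its own neighbour. Together with `image-flip²`
  -- it turns two vectors at distance 4 into disjoint pairs in the chart of a vector midway between
  -- them.
  image-unflip² : ∀ {i j} → i ≢ j → ∀ x → image x ≡ nb (proj₁ (state-chart (flip i (flip j x)))) i j
  image-unflip² {i} {j} i≢j x = step-at (proj₁ chart) (proj₂ chart) i≢j (step-back (proj₂ (state x)) (state-step i≢j x))
    where chart = state-chart (flip i (flip j x))

  image-onto : ∀ v → ∃ λ x → parity x ≡ false × image x ≡ v
  image-onto = connected _ (origin , parity-origin (suc n) , cong (λ s → proj₁ s zero) (fold-origin turn _)) extend
    where
    extend : ∀ {u v} → E u v → (∃ λ x → parity x ≡ false × image x ≡ u) → ∃ λ x → parity x ≡ false × image x ≡ v
    extend uv (x , px , refl) with nb-onto (proj₁ (state-chart x)) uv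
    ... | i , j , i≢j , eq = flip i (flip j x) , trans (parity-flip² i j x) px , trans (image-flip² i≢j x) eq

  cover : Cover E (suc n) false
  cover = record
    { q        = image
    ; near     = λ {x} _ i≢j → subst (E _) (sym (image-flip² i≢j x)) (nb-adj (proj₁ (state-chart x)) i≢j)
    ; far-¬adj = λ {x} _ → far-¬adj′ x
    ; far-≢    = λ {x} _ → far-≢′ x
    ; lift     = λ {x} _ adj → let i , j , i≢j , eq = nb-onto (proj₁ (state-chart x)) adj in
                   i , j , i≢j , trans (image-flip² i≢j x) eq
    ; onto     = image-onto
    }
    where
    far-¬adj′ : ∀ x {i j k l} → Unique (i ∷ j ∷ k ∷ l ∷ []) →
      ¬ E (image x) (image (flip i (flip j (flip k (flip l x)))))
    far-¬adj′ x {i} {j} {k} {l} ((i≢j ∷ i≢k ∷ i≢l ∷ []) ∷ (j≢k ∷ j≢l ∷ []) ∷ (k≢l ∷ []) ∷ _) =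
      subst₂ (λ v w → ¬ E v w) (sym (image-unflip² k≢l x)) (sym (image-flip² i≢j (flip k (flip l x))))
        (apart-¬adj (proj₁ (state-chart (flip k (flip l x)))) k≢l i≢j (≢-sym i≢k) (≢-sym j≢k) (≢-sym i≢l) (≢-sym j≢l))
    far-≢′ : ∀ x {i j k l} → Unique (i ∷ j ∷ k ∷ l ∷ []) →
      image x ≢ image (flip i (flip j (flip k (flip l x))))
    far-≢′ x {i} {j} {k} {l} ((i≢j ∷ i≢k ∷ i≢l ∷ []) ∷ (j≢k ∷ j≢l ∷ []) ∷ (k≢l ∷ []) ∷ _) =
      subst₂ _≢_ (sym (image-unflip² k≢l x)) (sym (image-flip² i≢j (flip k (flip l x))))
        (apart-≢ (proj₁ (state-chart (flip k (flip l x)))) k≢l i≢j (≢-sym i≢k) (≢-sym j≢k) (≢-sym i≢l) (≢-sym j≢l))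

-- Injectivity and rigidity of covers

module Covers {A : Set} (E : A → A → Set) (E-sym : Symmetric E) (E-irrefl : ∀ u → ¬ E u u) {n : ℕ} where

  open Charts E E-sym E-irrefl
  open Chart
  open Cover

  cover-chart : ∀ {b} (C : Cover E n b) {x} → parity x ≡ b → Chart n (q C x)
  cover-chart C {x} px = record
    { nb         = λ i j → q C (flip i (flip j x))
    ; nb-sym     = λ _ → cong (q C) (flip-comm _ _ x)
    ; nb-adj     = near C px
    ; nb-onto    = lift C px
    ; meet-adj   = λ {i} {j} {k} i≢j i≢k j≢k →
        subst (λ y → E (q C (flip i (flip j x))) (q C y)) (flip-exchange i j k x) (near C (p² i j) j≢k)
    ; apart-¬adj = λ {i} {j} {k} {l} i≢j k≢l i≢k i≢l j≢k j≢l →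
        subst (λ y → ¬ E (q C (flip i (flip j x))) (q C (flip k (flip l y)))) (flips-involutive (i ∷ j ∷ []) x)
          (far-¬adj C (p² i j) (unique₄ k≢l (≢-sym i≢k) (≢-sym j≢k) (≢-sym i≢l) (≢-sym j≢l) i≢j))
    ; apart-≢    = λ {i} {j} {k} {l} i≢j k≢l i≢k i≢l j≢k j≢l →
        subst (λ y → q C (flip i (flip j x)) ≢ q C (flip k (flip l y))) (flips-involutive (i ∷ j ∷ []) x)
          (far-≢ C (p² i j) (unique₄ k≢l (≢-sym i≢k) (≢-sym j≢k) (≢-sym i≢l) (≢-sym j≢l) i≢j))
    }
    where
    p² : ∀ i j → parity (flip i (flip j x)) ≡ _
    p² i j = trans (parity-flip² i j x) px

  -- Equal parity leaves the distances 2, 4 and 6, excluded by `near`, `far-≢` and `far-¬adj`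
  -- respectively.
  cover-injective : ∀ {b} (C : Cover E n b) {x y} → parity x ≡ b → parity y ≡ b →
    hamming x y ≤ 6 → q C x ≡ q C y → x ≡ y
  cover-injective C {x} {y} px py ≤6 eq with differ x y
  ... | is , uniq , refl , len = go is uniq (parity-≡⇒even-length is x (trans py (sym px))) (subst (_≤ 6) (sym len) ≤6) eq
    where
    go : ∀ is → Unique is → odd (length is) ≡ false → length is ≤ 6 → q C x ≡ q C (flips is x) → x ≡ flips is x
    go [] _ _ _ _ = refl
    go (i ∷ []) _ () _ _
    go (i ∷ j ∷ []) ((i≢j ∷ _) ∷ _) _ _ eq = contradiction (near C px i≢j) (E-≡-irrefl eq)
    go (i ∷ j ∷ k ∷ []) _ () _ _
    go (i ∷ j ∷ k ∷ l ∷ []) uniq _ _ eq = contradiction eq (far-≢ C px uniq)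
    go (i ∷ j ∷ k ∷ l ∷ r ∷ []) _ () _ _
    -- A vertex at distance 2 from y and 4 from x would be mapped to a neighbour of q x.
    go (i ∷ j ∷ k ∷ l ∷ r ∷ s ∷ []) ((i≢j ∷ _) ∷ (_ ∷ uniq)) _ _ eq =
      contradiction (E-sym (subst (E _) (sym eq) mid~y)) (far-¬adj C px uniq)
      where
      mid~y : E (q C (flips (k ∷ l ∷ r ∷ s ∷ []) x)) (q C (flips (i ∷ j ∷ k ∷ l ∷ r ∷ s ∷ []) x))
      mid~y = near C (trans (parity-flips (k ∷ l ∷ r ∷ s ∷ []) x) px) i≢j
    go (_ ∷ _ ∷ _ ∷ _ ∷ _ ∷ _ ∷ _ ∷ _) _ _ (s≤s (s≤s (s≤s (s≤s (s≤s (s≤s ())))))) _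

  -- Matching the charts at the two base vectors gives the permutation of `g`, and `act-carry` the
  -- translation. Agreement then spreads over the halved cube, because a chart is determined by one
  -- star.
  rigid : ∀ {b b′} → 5 ≤ n → (C : Cover E n b) (C′ : Cover E n b′) →
    ∀ {x₀ y₀} → parity x₀ ≡ b → parity y₀ ≡ b′ → q C x₀ ≡ q C′ y₀ →
    ∃ λ g → act g x₀ ≡ y₀ × (∀ {x} → parity x ≡ b → parity (act g x) ≡ b′ × q C x ≡ q C′ (act g x))
  rigid {b} {b′} 5≤n C C′ {x₀} {y₀} px₀ py₀ eq₀
    with charts-permuted 5≤n eq₀ (cover-chart C px₀) (cover-chart C′ py₀)
  ... | σ , permuted = g , g-x₀ , λ px → let _ , pgx , eq , _ = agreement px in pgx , eq
    where
    g : Aut n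
    g = x₀ ⊕ permute (P.flip σ) y₀ , σ
    g-x₀ : act g x₀ ≡ y₀
    g-x₀ = act-carry σ x₀ y₀
    -- The induction must carry agreement on the whole ball of radius 2 in the cube, since this is
    -- what fixes the chart at the next vector.
    Agree : Vtx n → Set
    Agree x = parity x ≡ b × parity (act g x) ≡ b′ × q C x ≡ q C′ (act g x) ×
      (∀ {i j} → i ≢ j → q C (flip i (flip j x)) ≡ q C′ (act g (flip i (flip j x))))
    agree₀ : Agree x₀
    agree₀ = px₀ , trans (cong parity g-x₀) py₀ , trans eq₀ (cong (q C′) (sym g-x₀)) ,
      λ {i} {j} i≢j → trans (permuted i≢j) (cong (q C′) (sym (trans (act-flip² g i j x₀) (cong (λ y → flip (σ ⟨$⟩ʳ i) (flip (σ ⟨$⟩ʳ j) y)) g-x₀))))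
    agree-flip² : ∀ {i j} → i ≢ j → ∀ x → Agree x → Agree (flip i (flip j x))
    agree-flip² {i} {j} i≢j x (px , pgx , eq , eqs) = px′ , pgx′ , eqs i≢j , λ {k} {l} k≢l →
      trans (pencil-determines-chart (eqs i≢j) (cover-chart C px′) (relabel σ (cover-chart C′ pgx′)) i on-pencil k≢l)
        (cong (q C′) (sym (act-flip² g k l x′)))
      where
      x′ : Vtx n
      x′ = flip i (flip j x)
      px′ : parity x′ ≡ b
      px′ = trans (parity-flip² i j x) px
      pgx′ : parity (act g x′) ≡ b′
      pgx′ = trans (cong parity (act-flip² g i j x)) (trans (parity-flip² (σ ⟨$⟩ʳ i) (σ ⟨$⟩ʳ j) (act g x)) pgx)
      -- The star of `i` at `x′` consists of `x` itself (for k = j) and of x + e_j + e_k, so it lies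
      -- in the ball around `x` that is already matched.
      on-ball : ∀ {k} → i ≢ k → q C (flip i (flip k x′)) ≡ q C′ (act g (flip i (flip k x′)))
      on-ball {k} i≢k with k ≟ j
      ... | yes refl = subst (λ y → q C y ≡ q C′ (act g y)) (sym (flips-involutive (i ∷ j ∷ []) x)) eq
      ... | no k≢j   = subst (λ y → q C y ≡ q C′ (act g y)) (sym (flip-cancelˡ i k (flip j x))) (eqs k≢j)
      on-pencil : ∀ {k} → i ≢ k →
        q C (flip i (flip k x′)) ≡ q C′ (flip (σ ⟨$⟩ʳ i) (flip (σ ⟨$⟩ʳ k) (act g x′)))
      on-pencil {k} i≢k = trans (on-ball i≢k) (cong (q C′) (act-flip² g i k x′))
    agreement : ∀ {x} → parity x ≡ b → Agree x
    agreement px = parity-induction Agree agree-flip² (trans px (sym px₀)) agree₀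

  -- Injectivity of the chart at the fixed vector shows that the permutation preserves every
  -- 2-subset. Given three labels, preserving both `ij` and `ik` fixes `i`; so the permutation is
  -- trivial, and with a fixed vector so is `g`.
  deck-fixing-point-trivial : ∀ {b} → 3 ≤ n → (C : Cover E n b) (g : Aut n) →
    (∀ {x} → parity x ≡ b → q C (act g x) ≡ q C x) →
    ∀ {x} → parity x ≡ b → act g x ≡ x → ∀ y → act g y ≡ y
  deck-fixing-point-trivial {b} 3≤n C g@(_ , σ) deck {x} px fix y with differ x y
  ... | is , _ , refl , _ = go is
    where
    endpoints : ∀ {i j} → i ≢ j → (σ ⟨$⟩ʳ i ≡ i × σ ⟨$⟩ʳ j ≡ j) ⊎ (σ ⟨$⟩ʳ i ≡ j × σ ⟨$⟩ʳ j ≡ i)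
    endpoints {i} {j} i≢j = nb-injective (cover-chart C px)
      (λ p → i≢j (trans (sym (P.inverseˡ σ)) (trans (cong (σ ⟨$⟩ˡ_) p) (P.inverseˡ σ)))) i≢j
      (trans (cong (q C) (trans (cong (λ z → flip (σ ⟨$⟩ʳ i) (flip (σ ⟨$⟩ʳ j) z)) (sym fix)) (sym (act-flip² g i j x))))
        (deck (trans (parity-flip² i j x) px)))
    σ-fixes : ∀ i → σ ⟨$⟩ʳ i ≡ i
    σ-fixes i with fresh (i ∷ []) (ℕ.≤-trans (s≤s (s≤s z≤n)) 3≤n)
    ... | j , j≢i ∷ [] with fresh (i ∷ j ∷ []) 3≤n
    ... | k , k≢i ∷ k≢j ∷ [] with endpoints (≢-sym j≢i) | endpoints (≢-sym k≢i)
    ...   | inj₁ (σi≡i , _) | _               = σi≡i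
    ...   | inj₂ _          | inj₁ (σi≡i , _) = σi≡i
    ...   | inj₂ (σi≡j , _) | inj₂ (σi≡k , _) = contradiction (trans (sym σi≡k) σi≡j) k≢j
    go : ∀ is → act g (flips is x) ≡ flips is x
    go []       = fix
    go (i ∷ is) = trans (act-flip g i (flips is x)) (cong₂ flip (σ-fixes i) (go is))

-- Charts as isomorphisms onto T_n

hamming-origin : (x : Vtx n) → hamming origin x ≡ weight x
hamming-origin []          = refl
hamming-origin (false ∷ x) = hamming-origin x
hamming-origin (true ∷ x)  = cong suc (hamming-origin x)

pair : Fin n → Fin n → Vtx n
pair i j = flip i (flip j origin)

weight-pair : {i j : Fin n} → i ≢ j → weight (pair i j) ≡ 2
weight-pair {i = i} {j} i≢j =
  trans (sym (hamming-origin (pair i j))) (hamming-flips ((i≢j ∷ []) ∷ [] ∷ []) origin)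

pair-onto : (s : Vtx n) → weight s ≡ 2 → ∃₂ λ i j → i ≢ j × pair i j ≡ s
pair-onto s |s|≡2 with differ origin s
... | is , uniq , eq , len = go is uniq eq (trans len (trans (hamming-origin s) |s|≡2))
  where
  go : ∀ is → Unique is → flips is origin ≡ s → length is ≡ 2 → ∃₂ λ i j → i ≢ j × pair i j ≡ s
  go (i ∷ j ∷ []) ((i≢j ∷ _) ∷ _) eq refl = i , j , i≢j , eq

-- `hamming` is the size of the symmetric difference, so adjacency in `T n` becomes a statement
-- about distance.
inclusion-exclusion : (s t : Vtx n) → hamming s t + (∣ s ∩ t ∣ + ∣ s ∩ t ∣) ≡ weight s + weight t
inclusion-exclusion []          []          = refl
inclusion-exclusion (false ∷ s) (false ∷ t) = inclusion-exclusion s t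
inclusion-exclusion (false ∷ s) (true ∷ t)  =
  trans (cong suc (inclusion-exclusion s t)) (sym (ℕ.+-suc (weight s) (weight t)))
inclusion-exclusion (true ∷ s)  (false ∷ t) = cong suc (inclusion-exclusion s t)
inclusion-exclusion (true ∷ s)  (true ∷ t)  = begin
  h + suc (c + suc c)           ≡⟨ cong (λ d → h + suc d) (ℕ.+-suc c c) ⟩
  h + suc (suc (c + c))         ≡⟨ ℕ.+-suc h _ ⟩
  suc (h + suc (c + c))         ≡⟨ cong suc (ℕ.+-suc h _) ⟩
  suc (suc (h + (c + c)))       ≡⟨ cong (λ d → suc (suc d)) (inclusion-exclusion s t) ⟩
  suc (suc (weight s + weight t)) ≡⟨ cong suc (ℕ.+-suc (weight s) (weight t)) ⟨
  suc (weight s + suc (weight t)) ∎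
  where
  open ≡-Reasoning
  h c : ℕ
  h = hamming s t
  c = ∣ s ∩ t ∣

double-injective : ∀ {c d} → c + c ≡ d + d → c ≡ d
double-injective {zero}  {zero}  _ = refl
double-injective {suc c} {suc d} p = cong suc (double-injective
  (ℕ.suc-injective (trans (sym (ℕ.+-suc c c)) (trans (ℕ.suc-injective p) (ℕ.+-suc d d)))))

shared : {i j k l : Fin n} → Pairs i j k l → ℕ
shared same         = 2
shared swap         = 2
shared (meetˡˡ _ _) = 1
shared (meetˡʳ _ _) = 1
shared (meetʳˡ _ _) = 1
shared (meetʳʳ _ _) = 1
shared (apart _ _ _ _) = 0

pair-∩ : {i j k l : Fin n} → i ≢ j → k ≢ l → (v : Pairs i j k l) → ∣ pair i j ∩ pair k l ∣ ≡ shared v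
pair-∩ {n} {i} {j} {k} {l} i≢j k≢l v = go v i≢j k≢l
  where
  -- The list `is` is the symmetric difference of the two pairs; the intersection size is found from
  -- |is| + 2c = 2 + 2.
  size : ∀ {i j k l : Fin n} (is : List (Fin n)) → Unique is → i ≢ j → k ≢ l → flips is (pair i j) ≡ pair k l →
    ∀ {c} → length is + (c + c) ≡ 4 → ∣ pair i j ∩ pair k l ∣ ≡ c
  size {i} {j} {k} {l} is uniq i≢j k≢l eq {c} sum = double-injective (ℕ.+-cancelˡ-≡ (length is) _ _ (begin
    length is + (d + d)                       ≡⟨ cong (_+ (d + d)) (sym (hamming-flips uniq (pair i j))) ⟩
    hamming (pair i j) (flips is (pair i j)) + (d + d) ≡⟨ cong (λ t → hamming (pair i j) t + (d + d)) eq ⟩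
    hamming (pair i j) (pair k l) + (d + d)   ≡⟨ inclusion-exclusion (pair i j) (pair k l) ⟩
    weight (pair i j) + weight (pair k l)     ≡⟨ cong₂ _+_ (weight-pair i≢j) (weight-pair k≢l) ⟩
    4                                         ≡⟨ sum ⟨
    length is + (c + c)                       ∎))
    where
    open ≡-Reasoning
    d : ℕ
    d = ∣ pair i j ∩ pair k l ∣
  unique₂ : ∀ {i j : Fin n} → i ≢ j → Unique (i ∷ j ∷ [])
  unique₂ i≢j = (i≢j ∷ []) ∷ [] ∷ []
  go : ∀ {i j k l} → (v : Pairs i j k l) → i ≢ j → k ≢ l → ∣ pair i j ∩ pair k l ∣ ≡ shared v
  go {i} {j} same i≢j k≢l = size [] [] i≢j k≢l refl refl
  go {i} {j} swap i≢j k≢l = size [] [] i≢j k≢l (flip-comm i j origin) refl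
  go {i} {j} {l = l} (meetˡˡ i≢l j≢l) i≢j k≢l =
    size (j ∷ l ∷ []) (unique₂ j≢l) i≢j k≢l (flip-exchange i j l origin) refl
  go {i} {j} {k} (meetˡʳ i≢k j≢k) i≢j k≢l =
    size (j ∷ k ∷ []) (unique₂ j≢k) i≢j k≢l (trans (flip-exchange i j k origin) (flip-comm i k origin)) refl
  go {i} {j} {l = l} (meetʳˡ i≢l j≢l) i≢j k≢l =
    size (i ∷ l ∷ []) (unique₂ i≢l) i≢j k≢l (flip-cancel i j l) refl
    where
    flip-cancel : ∀ i j l → flip i (flip l (pair i j)) ≡ pair j l
    flip-cancel i j l = trans (flip-cancelˡ i l (flip j origin)) (flip-comm l j origin)
  go {i} {j} {k} (meetʳʳ i≢k j≢k) i≢j k≢l =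
    size (i ∷ k ∷ []) (unique₂ i≢k) i≢j k≢l (flip-cancelˡ i k (flip j origin)) refl
  go {i} {j} {k} {l} (apart i≢k i≢l j≢k j≢l) i≢j k≢l =
    size (k ∷ l ∷ i ∷ j ∷ []) (unique₄ k≢l (≢-sym i≢k) (≢-sym j≢k) (≢-sym i≢l) (≢-sym j≢l) i≢j) i≢j k≢l
      (cong (λ x → flip k (flip l x)) (flips-involutive (i ∷ j ∷ []) origin)) refl

pair-injective : {i j k l : Fin n} → i ≢ j → k ≢ l → pair i j ≡ pair k l → (i ≡ k × j ≡ l) ⊎ (i ≡ l × j ≡ k)
pair-injective {i = i} {j} i≢j k≢l p = go (pairs i≢j k≢l) (trans (sym (pair-∩ i≢j k≢l (pairs i≢j k≢l)))
    (trans (cong (λ t → ∣ pair i j ∩ t ∣) (sym p)) (pair-∩ i≢j i≢j same)))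
  where
  go : ∀ {k l} (v : Pairs i j k l) → shared v ≡ 2 → (i ≡ k × j ≡ l) ⊎ (i ≡ l × j ≡ k)
  go same            _  = inj₁ (refl , refl)
  go swap            _  = inj₂ (refl , refl)
  go (meetˡˡ _ _)    ()
  go (meetˡʳ _ _)    ()
  go (meetʳˡ _ _)    ()
  go (meetʳʳ _ _)    ()
  go (apart _ _ _ _) ()

module LocalGraph {m : ℕ} (E : Fin m → Fin m → Set) (E-sym : Symmetric E) (E-irrefl : ∀ u → ¬ E u u) {n : ℕ} {u : Fin m} where

  open Charts E E-sym E-irrefl
  open Chart

  -- `nb-onto` returns the labels of a neighbour in one of two orders; `pair` forgets the order, so
  -- the choice does not show.
  chart⇒iso : Chart n u → Iso (Induced (finGraph m E) (E u)) (T n)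
  chart⇒iso ch = record
    { f      = f
    ; f-≈    = λ v w → mk⇔ (f-cong v w) (f-injective v w)
    ; f-surj = λ (s , |s|≡2) → let i , j , i≢j , eq = pair-onto s |s|≡2 in
        (nb ch i j , nb-adj ch i≢j) , trans (f-nb i≢j (nb-adj ch i≢j)) eq
    ; f-adj  = f-adj
    }
    where
    f : Σ (Fin m) (E u) → Σ (Subset n) (λ s → ∣ s ∣ ≡ 2)
    f (v , uv) = let i , j , i≢j , _ = nb-onto ch uv in pair i j , weight-pair i≢j
    same-pair : ∀ {i j k l : Fin n} → (i ≡ k × j ≡ l) ⊎ (i ≡ l × j ≡ k) → pair i j ≡ pair k l
    same-pair (inj₁ (refl , refl)) = refl
    same-pair (inj₂ (refl , refl)) = flip-comm _ _ origin
    f-nb : ∀ {i j} → i ≢ j → (uv : E u (nb ch i j)) → proj₁ (f (nb ch i j , uv)) ≡ pair i j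
    f-nb i≢j uv with nb-onto ch uv
    ... | k , l , k≢l , eq = same-pair (nb-injective ch k≢l i≢j eq)
    f-cong : ∀ v w → proj₁ v ≡ proj₁ w → proj₁ (f v) ≡ proj₁ (f w)
    f-cong (v , uv) (.v , uw) refl with nb-onto ch uv
    ... | i , j , i≢j , refl = sym (f-nb i≢j uw)
    f-injective : ∀ v w → proj₁ (f v) ≡ proj₁ (f w) → proj₁ v ≡ proj₁ w
    f-injective (v , uv) (w , uw) p with nb-onto ch uv | nb-onto ch uw
    ... | i , j , i≢j , refl | k , l , k≢l , refl with pair-injective i≢j k≢l p
    ...   | inj₁ (refl , refl) = refl
    ...   | inj₂ (refl , refl) = nb-sym ch i≢j
    f-adj : ∀ v w → E (proj₁ v) (proj₁ w) ⇔ ∣ proj₁ (f v) ∩ proj₁ (f w) ∣ ≡ 1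
    f-adj (v , uv) (w , uw) with nb-onto ch uv | nb-onto ch uw
    ... | i , j , i≢j , refl | k , l , k≢l , refl =
      mk⇔ (λ vw → trans (pair-∩ i≢j k≢l _) (to k≢l (pairs i≢j k≢l) vw))
          (λ ∩≡1 → from (pairs i≢j k≢l) (trans (sym (pair-∩ i≢j k≢l _)) ∩≡1))
      where
      to : ∀ {k l} → k ≢ l → (v : Pairs i j k l) → E (nb ch i j) (nb ch k l) → shared v ≡ 1
      to k≢l same            vw = contradiction vw (E-irrefl _)
      to k≢l swap            vw = contradiction vw (E-≡-irrefl (nb-sym ch i≢j))
      to k≢l (meetˡˡ _ _)    _  = refl
      to k≢l (meetˡʳ _ _)    _  = refl
      to k≢l (meetʳˡ _ _)    _  = refl
      to k≢l (meetʳʳ _ _)    _  = refl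
      to k≢l (apart p q r s) vw = contradiction vw (apart-¬adj ch i≢j k≢l p q r s)
      from : ∀ {k l} (v : Pairs i j k l) → shared v ≡ 1 → E (nb ch i j) (nb ch k l)
      from (meetˡˡ i≢l j≢l) _ = meet-adj ch i≢j i≢l j≢l
      from (meetˡʳ i≢k j≢k) _ = meet-adjˡʳ ch i≢j i≢k j≢k
      from (meetʳˡ i≢l j≢l) _ = meet-adjʳˡ ch i≢j j≢l i≢l
      from (meetʳʳ i≢k j≢k) _ = meet-adjʳ ch i≢j (≢-sym j≢k) i≢k

  iso⇒chart : Iso (Induced (finGraph m E) (E u)) (T n) → Chart n u
  iso⇒chart iso = record
    { nb         = label
    ; nb-sym     = λ i≢j → label-≡ i≢j (≢-sym i≢j) (flip-comm _ _ origin)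
    ; nb-adj     = proj₁ ∘ label-spec
    ; nb-onto    = onto
    ; meet-adj   = λ i≢j i≢k j≢k → from (f-adj _ _) (trans (∩-labels i≢j i≢k) (pair-∩ i≢j i≢k (meetˡˡ i≢k j≢k)))
    ; apart-¬adj = λ i≢j k≢l p q r s adj → contradiction
        (trans (sym (trans (∩-labels i≢j k≢l) (pair-∩ i≢j k≢l (apart p q r s)))) (to (f-adj (_ , proj₁ (label-spec i≢j)) (_ , proj₁ (label-spec k≢l))) adj)) (λ ())
    ; apart-≢    = λ i≢j k≢l p q r s eq → case pair-injective i≢j k≢l
        (trans (sym (proj₂ (label-spec i≢j))) (trans (to (f-≈ (_ , proj₁ (label-spec i≢j)) (_ , proj₁ (label-spec k≢l))) eq) (proj₂ (label-spec k≢l)))) of λ where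
          (inj₁ (i≡k , _)) → p i≡k
          (inj₂ (i≡l , _)) → q i≡l
    }
    where
    open Iso iso
    open Equivalence
    label : Fin n → Fin n → Fin m
    label i j with i ≟ j
    -- A default value: the diagonal of a chart carries no information.
    ... | yes _  = u
    ... | no i≢j = proj₁ (proj₁ (f-surj (pair i j , weight-pair i≢j)))
    label-spec : ∀ {i j} → i ≢ j → Σ (E u (label i j)) λ uv → proj₁ (f (label i j , uv)) ≡ pair i j
    label-spec {i} {j} i≢j with i ≟ j
    ... | yes i≡j = contradiction i≡j i≢j
    ... | no i≢j′ = let (_ , uv) , eq = f-surj (pair i j , weight-pair i≢j′) in uv , eq
    label-≡ : ∀ {i j k l} → i ≢ j → k ≢ l → pair i j ≡ pair k l → label i j ≡ label k l
    label-≡ i≢j k≢l p = from (f-≈ (_ , proj₁ (label-spec i≢j)) (_ , proj₁ (label-spec k≢l)))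
      (trans (proj₂ (label-spec i≢j)) (trans p (sym (proj₂ (label-spec k≢l)))))
    ∩-labels : ∀ {i j k l} (i≢j : i ≢ j) (k≢l : k ≢ l) →
      ∣ proj₁ (f (_ , proj₁ (label-spec i≢j))) ∩ proj₁ (f (_ , proj₁ (label-spec k≢l))) ∣ ≡ ∣ pair i j ∩ pair k l ∣
    ∩-labels i≢j k≢l = cong₂ (λ s t → ∣ s ∩ t ∣) (proj₂ (label-spec i≢j)) (proj₂ (label-spec k≢l))
    onto : ∀ {v} → E u v → ∃₂ λ i j → i ≢ j × label i j ≡ v
    onto {v} uv with pair-onto (proj₁ (f (v , uv))) (proj₂ (f (v , uv)))
    ... | i , j , i≢j , eq = i , j , i≢j ,
      from (f-≈ (_ , proj₁ (label-spec i≢j)) (v , uv)) (trans (proj₂ (label-spec i≢j)) eq)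

-- Orbits and normal quotients

parity-even : ∀ {n} {x : Vtx n} → 2 ∣ weight x → parity x ≡ false
parity-even {x = x} 2∣x = trans (parity≡odd-weight x) (2∣⇒even 2∣x)

module Orbits {n : ℕ} (K : Subgroup n) (K-even : Even K) where

  -- A record in place of the existential in `Quot`, so that `x` and `y` can be inferred from a
  -- proof.
  record Orbit (x y : Vtx n) : Set where
    constructor via
    field
      {element} : Aut n
      member    : mem K element
      carries   : act element x ≡ y

  orbit⇒≈ : ∀ {x y} → Orbit x y → _≈_ (Quot K) x y
  orbit⇒≈ (via {k} k∈K eq) = k , k∈K , eq

  ≈⇒orbit : ∀ {x y} → _≈_ (Quot K) x y → Orbit x y
  ≈⇒orbit (k , k∈K , eq) = via k∈K eq

  orbit-refl : ∀ {x} → Orbit x x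
  orbit-refl {x} = via (has-e K) (act-e x)

  orbit-sym : ∀ {x y} → Orbit x y → Orbit y x
  orbit-sym {x} (via {k} k∈K refl) = via (inv K k∈K) (act-⁻¹-act k x)

  orbit-trans : ∀ {x y z} → Orbit x y → Orbit y z → Orbit x z
  orbit-trans {x} (via {k} k∈K refl) (via {l} l∈K refl) = via (closed K k∈K l∈K) (act-· k l x)

  parity-orbit : ∀ {x y} → Orbit x y → parity y ≡ parity x
  parity-orbit {x} (via {k} k∈K refl) = trans (parity-act k x)
    (trans (cong (parity x xor_) (parity-even {x = proj₁ k} (K-even k k∈K))) (xor-identityʳ _))

  flip-≁ : ∀ {x y i} → Orbit (flip i x) y → ¬ Orbit x y
  flip-≁ {x} {i = i} fx∼y x∼y =
    not-¬ (parity-orbit x∼y) (trans (parity-orbit fx∼y) (parity-flip i x))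

  private
    unact : ∀ (k : Aut n) i x → act k (flip (proj₂ k ⟨$⟩ˡ i) x) ≡ flip i (act k x)
    unact k i x = trans (act-flip k _ x) (cong (λ j → flip j (act k x)) (P.inverseʳ (proj₂ k)))

  -- The adjacent members are moved back by the element `k` that was applied to `x`; the label of
  -- the flip is pulled back along its permutation.
  quot-adj⇒flip : ∀ x y → _~_ (Quot K) x y → ∃ λ i → Orbit (flip i x) y
  quot-adj⇒flip x y (_ , k , k′ , k∈K , k′∈K , h≡1) with differ (act k x) (act k′ y)
  ... | [] , _ , _ , len = contradiction (trans len h≡1) (λ ())
  ... | i ∷ [] , _ , eq , _ = proj₂ k ⟨$⟩ˡ i ,
    orbit-trans (via {element = k} k∈K (trans (unact k i x) eq)) (orbit-sym (via {element = k′} k′∈K refl))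
  ... | _ ∷ _ ∷ _ , _ , _ , len = contradiction (trans len h≡1) (λ ())

  flip⇒quot-adj : ∀ {x y i} → Orbit (flip i x) y → _~_ (Quot K) x y
  flip⇒quot-adj {x} {y} {i} fx∼y = flip-≁ fx∼y ∘ ≈⇒orbit , e , element y∼fx , has-e K , member y∼fx ,
    trans (cong₂ hamming (act-e x) (carries y∼fx)) (hamming-flips {is = i ∷ []} ([] ∷ []) x)
    where
    open Orbit
    y∼fx : Orbit y (flip i x)
    y∼fx = orbit-sym fx∼y

  dist2⇒flip² : ∀ x y → _~_ (Dist2 (Quot K)) x y → ∃₂ λ i j → i ≢ j × Orbit (flip i (flip j x)) y
  dist2⇒flip² x y (x≁y , _ , w , x~w , w~y) with quot-adj⇒flip x w x~w | quot-adj⇒flip w y w~y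
  ... | j , via {k} k∈K refl | i , fw∼y = go (proj₂ k ⟨$⟩ˡ i ≟ j)
    where
    fffx∼y : Orbit (flip (proj₂ k ⟨$⟩ˡ i) (flip j x)) y
    fffx∼y = orbit-trans (via {element = k} k∈K (unact k i (flip j x))) fw∼y
    go : Dec (proj₂ k ⟨$⟩ˡ i ≡ j) → ∃₂ λ i j → i ≢ j × Orbit (flip i (flip j x)) y
    -- Two flips with the same label would cancel and leave `y` in the orbit of `x`.
    go (yes refl) = contradiction (subst (λ z → Orbit z y) (flip-involutive _ x) fffx∼y) (x≁y ∘ orbit⇒≈)
    go (no i≢j)   = _ , j , i≢j , fffx∼y

  flip²-orbit : ∀ {x y i j} → Orbit x y → i ≢ j → ∃₂ λ k l → k ≢ l × Orbit (flip i (flip j x)) (flip k (flip l y))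
  flip²-orbit {x} {i = i} {j} (via {k} k∈K refl) i≢j = proj₂ k ⟨$⟩ʳ i , proj₂ k ⟨$⟩ʳ j ,
    (λ p → i≢j (trans (sym (P.inverseˡ (proj₂ k))) (trans (cong (proj₂ k ⟨$⟩ˡ_) p) (P.inverseˡ (proj₂ k))))) ,
    via {element = k} k∈K (act-flip² k i j x)

  module _ (K-sparse : dK≥ K 7) where

    -- `dK≥` only refutes that `k` is nontrivial; decidable equality of vectors turns this double
    -- negation into an equation at each `y`.
    short⇒fixes : ∀ {k x} → mem K k → hamming x (act k x) ≤ 6 → ∀ y → act k y ≡ y
    short⇒fixes {k} {x} k∈K short y = decidable-stable (≡-dec Bool._≟_ (act k y) y) λ moves →
      ℕ.<⇒≱ (s≤s short) (K-sparse k k∈K (λ k≈e → moves (trans (act-cong {g = k} {h = e} k≈e y) (act-e y))) x)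

    short-orbit : ∀ {x} (is : List (Fin n)) → length is ≤ 6 → Orbit x (flips is x) → x ≡ flips is x
    short-orbit {x} is len (via {k} k∈K eq) = trans (sym (short⇒fixes {k} {x} k∈K
      (subst (λ y → hamming x y ≤ 6) (sym eq) (ℕ.≤-trans (hamming-flips-≤ is x) len)) x)) eq

    -- Undoing two flips and making four others takes six, so sparseness would force the two vectors
    -- to coincide, although their distances from `x` are 2 and 4.
    ¬orbit-2-4 : ∀ x {i j k l r s} → r ≢ s → Unique (i ∷ j ∷ k ∷ l ∷ []) →
      ¬ Orbit (flip r (flip s x)) (flips (i ∷ j ∷ k ∷ l ∷ []) x)
    ¬orbit-2-4 x {i} {j} {k} {l} {r} {s} r≢s uniq ffx∼y = contradiction
      (trans (sym (hamming-flips {is = r ∷ s ∷ []} ((r≢s ∷ []) ∷ [] ∷ []) x))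
        (trans (cong (hamming x) z≡y) (hamming-flips uniq x))) λ ()
      where
      is : List (Fin n)
      is = i ∷ j ∷ k ∷ l ∷ r ∷ s ∷ []
      z y : Vtx n
      z = flip r (flip s x)
      y = flips (i ∷ j ∷ k ∷ l ∷ []) x
      y≡ : flips is z ≡ y
      y≡ = cong (flips (i ∷ j ∷ k ∷ l ∷ [])) (flips-involutive (r ∷ s ∷ []) x)
      z≡y : z ≡ y
      z≡y = trans (short-orbit is ℕ.≤-refl (subst (Orbit z) (sym y≡) ffx∼y)) y≡

    flip²⇒dist2 : ∀ {x y i j} → i ≢ j → Orbit (flip i (flip j x)) y → _~_ (Dist2 (Quot K)) x y
    flip²⇒dist2 {x} {y} {i} {j} i≢j ffx∼y = x≁y ∘ ≈⇒orbit , ¬adj , flip j x , flip⇒quot-adj orbit-refl , flip⇒quot-adj ffx∼y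
      where
      x≁y : ¬ Orbit x y
      x≁y x∼y = contradiction (trans (sym (hamming-refl x)) (trans (cong (hamming x)
          (short-orbit (i ∷ j ∷ []) (s≤s (s≤s z≤n)) (orbit-trans x∼y (orbit-sym ffx∼y))))
          (hamming-flips {is = i ∷ j ∷ []} ((i≢j ∷ []) ∷ [] ∷ []) x))) λ ()
      ¬adj : ¬ _~_ (Quot K) x y
      ¬adj x~y with quot-adj⇒flip x y x~y
      ... | k , fx∼y = not-¬ (trans (parity-orbit ffx∼y) (parity-flip² i j x))
        (trans (parity-orbit fx∼y) (parity-flip k x))

    dist2-resp : ∀ {x x′ y y′} → Orbit x x′ → Orbit y y′ → _~_ (Dist2 (Quot K)) x y → _~_ (Dist2 (Quot K)) x′ y′
    dist2-resp {x} {y = y} x∼x′ y∼y′ d with dist2⇒flip² x y d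
    ... | i , j , i≢j , ffx∼y with flip²-orbit x∼x′ i≢j
    ...   | k , l , k≢l , ffx∼ffx′ = flip²⇒dist2 k≢l (orbit-trans (orbit-sym ffx∼ffx′) (orbit-trans ffx∼y y∼y′))

    walk-parity : ∀ {x y} → Walk (Dist2 (Quot K)) x y → parity y ≡ parity x
    walk-parity {x} {y} (here x∼y) = parity-orbit (≈⇒orbit {x} {y} x∼y)
    walk-parity {x} (step {w = z} d w) with dist2⇒flip² x z d
    ... | i , j , _ , ffx∼w = trans (walk-parity w) (trans (parity-orbit ffx∼w) (parity-flip² i j x))

    parity-walk : ∀ {x y} → parity x ≡ parity y → Walk (Dist2 (Quot K)) x y
    parity-walk {x} {y} p = parity-induction (λ z → Walk (Dist2 (Quot K)) z y)
      (λ {i} {j} i≢j z w → step (flip²⇒dist2 i≢j (subst (λ v → Orbit v z) (sym (flips-involutive (i ∷ j ∷ []) z)) orbit-refl)) w)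
      {y} {x} p (here (orbit⇒≈ (orbit-refl {y})))

    module FromHalved {m : ℕ} (E : Fin m → Fin m → Set) {v₀ : Vtx n} (iso : Iso (finGraph m E) (Induced (Dist2 (Quot K)) (Walk (Dist2 (Quot K)) v₀))) where

      open Iso iso
      open Equivalence

      vertex : Fin m → Vtx n
      vertex u = proj₁ (f u)

      preimage : ∀ {x} → Dec (parity v₀ ≡ parity x) → Fin m
      preimage {x} (yes p) = proj₁ (f-surj (x , parity-walk p))
      -- A default value for vectors of the other parity, on which a cover is never read.
      preimage     (no _)  = proj₁ (f-surj (v₀ , here (orbit⇒≈ orbit-refl)))

      class : Vtx n → Fin m
      class x = preimage {x} (parity v₀ Bool.≟ parity x)

      vertex-class : ∀ {x} → parity x ≡ parity v₀ → Orbit (vertex (class x)) x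
      vertex-class {x} p with parity v₀ Bool.≟ parity x
      ... | yes p′ = ≈⇒orbit (proj₂ (f-surj (x , parity-walk p′)))
      ... | no ¬p  = contradiction (sym p) ¬p

      class-≡⇒orbit : ∀ {x y} → parity x ≡ parity v₀ → parity y ≡ parity v₀ → class x ≡ class y → Orbit x y
      class-≡⇒orbit {x} {y} px py eq = orbit-trans (orbit-sym (vertex-class px))
        (subst (λ u → Orbit (vertex u) y) (sym eq) (vertex-class py))

      orbit⇒class-≡ : ∀ {x y} → parity x ≡ parity v₀ → parity y ≡ parity v₀ → Orbit x y → class x ≡ class y
      orbit⇒class-≡ {x} {y} px py x∼y = from (f-≈ (class x) (class y)) (orbit⇒≈
        (orbit-trans (vertex-class px) (orbit-trans x∼y (orbit-sym (vertex-class py)))))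

      vertex-parity : ∀ u → parity (vertex u) ≡ parity v₀
      vertex-parity u = walk-parity (proj₂ (f u))

      class-vertex : ∀ u → class (vertex u) ≡ u
      class-vertex u = from (f-≈ (class (vertex u)) u) (orbit⇒≈ (vertex-class (vertex-parity u)))

      class-adj⇒flip² : ∀ {x y} → parity x ≡ parity v₀ → parity y ≡ parity v₀ → E (class x) (class y) →
        ∃₂ λ i j → i ≢ j × Orbit (flip i (flip j x)) y
      class-adj⇒flip² {x} {y} px py adj = dist2⇒flip² x y (dist2-resp (vertex-class px) (vertex-class py) (to (f-adj (class x) (class y)) adj))

      -- The base vertex `v₀` decides which half of the quotient the graph is, hence the parity of
      -- the cover. Exclusion of adjacency at distance 4 rests on `¬orbit-2-4`.
      orbit-cover : Cover E n (parity v₀)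
      orbit-cover = record
        { q        = class
        ; near     = λ {x} {i} {j} px i≢j → from (f-adj (class x) (class (flip i (flip j x)))) (dist2-resp (orbit-sym (vertex-class px))
            (orbit-sym (vertex-class (trans (parity-flip² i j x) px))) (flip²⇒dist2 i≢j orbit-refl))
        ; far-¬adj = far-¬adj
        ; far-≢    = λ {x} {i} {j} {k} {l} px uniq eq → contradiction
            (trans (sym (hamming-refl x)) (trans (cong (hamming x)
              (short-orbit (i ∷ j ∷ k ∷ l ∷ []) (s≤s (s≤s (s≤s (s≤s z≤n))))
                (class-≡⇒orbit px (p⁴ i j k l px) eq)))
              (hamming-flips uniq x))) λ ()
        ; lift     = lift
        ; onto     = λ u → vertex u , vertex-parity u , class-vertex u
        }
        where
        p⁴ : ∀ {x} i j k l → parity x ≡ parity v₀ → parity (flips (i ∷ j ∷ k ∷ l ∷ []) x) ≡ parity v₀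
        p⁴ {x} i j k l px = trans (parity-flips (i ∷ j ∷ k ∷ l ∷ []) x) px
        far-¬adj : ∀ {x i j k l} → parity x ≡ parity v₀ → Unique (i ∷ j ∷ k ∷ l ∷ []) →
          ¬ E (class x) (class (flips (i ∷ j ∷ k ∷ l ∷ []) x))
        far-¬adj {x} {i} {j} {k} {l} px uniq adj =
          let _ , _ , r≢s , ffx∼y = class-adj⇒flip² px (p⁴ i j k l px) adj in ¬orbit-2-4 x r≢s uniq ffx∼y
        lift : ∀ {x u} → parity x ≡ parity v₀ → E (class x) u → ∃₂ λ i j → i ≢ j × class (flip i (flip j x)) ≡ u
        lift {x} {u} px adj =
          let i , j , i≢j , ffx∼u = class-adj⇒flip² px (vertex-parity u) (subst (E (class x)) (sym (class-vertex u)) adj)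
          in i , j , i≢j , trans (orbit⇒class-≡ (trans (parity-flip² i j x) px) (vertex-parity u) ffx∼u) (class-vertex u)

-- Deck groups and conjugacy

act-conj : (g h : Aut n) (v : Vtx n) → act g (act ((g · h) · (g ⁻¹)) v) ≡ act h (act g v)
act-conj g h v = begin
  act g (act ((g · h) · (g ⁻¹)) v)   ≡⟨ cong (act g) (act-· (g · h) (g ⁻¹) v) ⟩
  act g (act (g ⁻¹) (act (g · h) v)) ≡⟨ act-act-⁻¹ g (act (g · h) v) ⟩
  act (g · h) v                      ≡⟨ act-· g h v ⟩
  act h (act g v)                    ∎
  where open ≡-Reasoning

xor-injectiveʳ : ∀ {a b} c → a xor c ≡ b xor c → a ≡ b
xor-injectiveʳ {false} {false} c     _  = refl
xor-injectiveʳ {true}  {true}  c     _  = refl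
xor-injectiveʳ {false} {true}  false ()
xor-injectiveʳ {false} {true}  true  ()
xor-injectiveʳ {true}  {false} false ()
xor-injectiveʳ {true}  {false} true  ()

parity-act-injective : (g : Aut n) {x y : Vtx n} → parity (act g x) ≡ parity (act g y) → parity x ≡ parity y
parity-act-injective g {x} {y} p = xor-injectiveʳ (parity (proj₁ g))
  (trans (sym (parity-act g x)) (trans p (parity-act g y)))

module _ {m : ℕ} {E : Fin m → Fin m → Set} (E-sym : Symmetric E) (E-irrefl : ∀ u → ¬ E u u) where

  open Charts E E-sym E-irrefl using (Chart)
  open Chart
  open Covers E E-sym E-irrefl
  open Cover

  covered⇒connected : ∀ {b} → Cover E n b → Vtx n → Connected (finGraph m E)
  covered⇒connected {b = b} C x₀ = q C x₀ , λ u v →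
    let x , px , qx≡u = onto C u
        y , py , qy≡v = onto C v
    in subst₂ (Walk (finGraph m E)) qx≡u qy≡v (proj₂ (parity-induction
         (λ z → parity z ≡ b × Walk (finGraph m E) (q C z) (q C y))
         (λ {i} {j} i≢j z (pz , w) → trans (parity-flip² i j z) pz , step (E-sym (near C pz i≢j)) w)
         {y} {x} (trans px (sym py)) (py , here refl)))

  covered⇒locallyT : ∀ {b} → Cover E n b → LocallyT n (finGraph m E)
  covered⇒locallyT C u = let x , px , qx≡u = onto C u in
    LocalGraph.chart⇒iso E E-sym E-irrefl (subst (Chart _) qx≡u (cover-chart C px))

  locallyT⇒cover : 2 ≤ n → Connected (finGraph m E) → LocallyT n (finGraph m E) → Cover E n false
  locallyT⇒cover {suc n} 2≤n (u₀ , walks) local =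
    Unfolding.cover E E-sym E-irrefl 2≤n (λ u → LocalGraph.iso⇒chart E E-sym E-irrefl (local u)) u₀
      (λ P P-u₀ P-step v → along P P-step (walks u₀ v) P-u₀)
    where
    along : ∀ (P : Fin m → Set) → (∀ {u v} → E u v → P u → P v) →
      ∀ {u v} → Walk (finGraph m E) u v → P u → P v
    along P P-step (here refl) P-u = P-u
    along P P-step (step uw w) P-u = along P P-step w (P-step uw P-u)

  -- The deck group of a cover and its quotient

  module DeckGroup {n : ℕ} (2≤n : 2 ≤ n) (C : Cover E n false) where

    -- For n ≤ 6 the group must be trivial, but a nontrivial g can satisfy the
    -- invariance condition: for n = 2 the swap fixes every even vector.
    record Deck (g : Aut n) : Set where
      constructor deck
      field
        even         : parity (proj₁ g) ≡ false
        invariant    : ∀ x → parity x ≡ false → q C (act g x) ≡ q C x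
        trivial⊎wide : (∀ x → act g x ≡ x) ⊎ 7 ≤ n

    open Deck

    parity-even-act : ∀ (g : Aut n) x → parity (proj₁ g) ≡ false → parity x ≡ false → parity (act g x) ≡ false
    parity-even-act g x pg px = trans (parity-act g x) (cong₂ _xor_ px pg)

    deck-e : Deck e
    deck-e = deck (parity-origin n) (λ x _ → cong (q C) (act-e x)) (inj₁ act-e)

    deck-· : ∀ {g h} → Deck g → Deck h → Deck (g · h)
    deck-· {g} {h} dg dh = deck even-gh
      (λ x px → trans (cong (q C) (act-· g h x))
        (trans (invariant dh (act g x) (parity-even-act g x (even dg) px)) (invariant dg x px)))
      (trivial-gh (trivial⊎wide dg) (trivial⊎wide dh))
      where
      even-gh : parity (proj₁ (g · h)) ≡ false
      even-gh = trans (parity-⊕ (proj₁ g) _)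
        (cong₂ _xor_ (even dg) (trans (parity-permute (P.flip (proj₂ g)) (proj₁ h)) (even dh)))
      trivial-gh : (∀ x → act g x ≡ x) ⊎ 7 ≤ n → (∀ x → act h x ≡ x) ⊎ 7 ≤ n → (∀ x → act (g · h) x ≡ x) ⊎ 7 ≤ n
      trivial-gh (inj₂ 7≤n) _          = inj₂ 7≤n
      trivial-gh (inj₁ _)   (inj₂ 7≤n) = inj₂ 7≤n
      trivial-gh (inj₁ tg)  (inj₁ th)  = inj₁ λ x → trans (act-· g h x) (trans (th (act g x)) (tg x))

    deck-⁻¹ : ∀ {g} → Deck g → Deck (g ⁻¹)
    deck-⁻¹ {g} dg = deck even-g⁻¹
      (λ x px → trans (sym (invariant dg (act (g ⁻¹) x) (parity-even-act (g ⁻¹) x even-g⁻¹ px)))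
        (cong (q C) (act-act-⁻¹ g x)))
      (trivial-g⁻¹ (trivial⊎wide dg))
      where
      even-g⁻¹ : parity (proj₁ (g ⁻¹)) ≡ false
      even-g⁻¹ = trans (parity-permute (proj₂ g) (proj₁ g)) (even dg)
      trivial-g⁻¹ : (∀ x → act g x ≡ x) ⊎ 7 ≤ n → (∀ x → act (g ⁻¹) x ≡ x) ⊎ 7 ≤ n
      trivial-g⁻¹ (inj₁ tg)  = inj₁ λ x → trans (sym (tg (act (g ⁻¹) x))) (act-act-⁻¹ g x)
      trivial-g⁻¹ (inj₂ 7≤n) = inj₂ 7≤n

    deck-resp : ∀ {g h} → g ≈ₐ h → Deck g → Deck h
    deck-resp {g} {h} g≈h dg = deck (trans (cong parity (sym (proj₁ g≈h))) (even dg))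
      (λ x px → trans (cong (q C) (sym (acts≡ x))) (invariant dg x px))
      (trivial-h (trivial⊎wide dg))
      where
      acts≡ : ∀ x → act g x ≡ act h x
      acts≡ = act-cong {g = g} {h = h} g≈h
      trivial-h : (∀ x → act g x ≡ x) ⊎ 7 ≤ n → (∀ x → act h x ≡ x) ⊎ 7 ≤ n
      trivial-h (inj₁ tg)  = inj₁ λ x → trans (sym (acts≡ x)) (tg x)
      trivial-h (inj₂ 7≤n) = inj₂ 7≤n

    K : Subgroup n
    K = record { mem = Deck ; resp = λ {g} {h} → deck-resp {g} {h} ; has-e = deck-e ; closed = deck-· ; inv = deck-⁻¹ }

    K-even : Even K
    K-even k k∈K = even⇒2∣ _ (trans (sym (parity≡odd-weight (proj₁ k))) (even k∈K))

    short-deck-trivial : ∀ {k x} → Deck k → parity x ≡ false → hamming x (act k x) ≤ 6 → k ≈ₐ e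
    short-deck-trivial {k} {x} dk px short = act-faithful {g = k} {h = e} λ v → trans (trivial (trivial⊎wide dk) v) (sym (act-e v))
      where
      trivial : (∀ y → act k y ≡ y) ⊎ 7 ≤ n → ∀ y → act k y ≡ y
      trivial (inj₁ tk)  = tk
      trivial (inj₂ 7≤n) = deck-fixing-point-trivial (ℕ.≤-trans (s≤s (s≤s (s≤s z≤n))) 7≤n) C k
        (invariant dk _) px
        (sym (cover-injective C px (parity-even-act k x (even dk) px) short (sym (invariant dk x px))))

    -- Invariance speaks of even vectors only, so an odd vector is traded for a neighbour. Flipping
    -- the first label of a path from `x` to its image removes one flip and adds one, so the
    -- displacement does not grow; at a fixed vector it becomes at most 2.
    neighbour-short : ∀ k x → hamming x (act k x) ≤ 6 → ∃ λ i → hamming (flip i x) (act k (flip i x)) ≤ 6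
    neighbour-short k x short with differ x (act k x)
    ... | is , _ , eq , len = go is eq (subst (_≤ 6) (sym len) short)
      where
      moved : ∀ i js → flips js (flip i x) ≡ act k x → suc (length js) ≤ 6 →
        hamming (flip i x) (act k (flip i x)) ≤ 6
      moved i js eq ≤6 = ℕ.≤-trans (subst (λ y → hamming (flip i x) y ≤ suc (length js))
        (trans (cong (flip _) eq) (sym (act-flip k i x)))
        (hamming-flips-≤ ((proj₂ k ⟨$⟩ʳ i) ∷ js) (flip i x))) ≤6
      go : ∀ is → flips is x ≡ act k x → length is ≤ 6 → ∃ λ i → hamming (flip i x) (act k (flip i x)) ≤ 6
      go [] eq _ = let i , _ = fresh [] (ℕ.≤-trans (s≤s z≤n) 2≤n) in
        i , moved i (i ∷ []) (trans (flip-involutive i x) eq) (s≤s (s≤s z≤n))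
      go (i ∷ is) eq ≤6 = i , moved i is (trans (flips-flip is i x) eq) ≤6

    K-sparse : dK≥ K 7
    K-sparse k k∈K k≉e x with 7 ℕ.≤? hamming x (act k x)
    ... | yes 7≤ = 7≤
    ... | no 7≰ = contradiction (trivial (parity x) refl (ℕ.≤-pred (ℕ.≰⇒> 7≰))) k≉e
      where
      trivial : ∀ b → parity x ≡ b → hamming x (act k x) ≤ 6 → k ≈ₐ e
      trivial false px short = short-deck-trivial {k} {x} k∈K px short
      trivial true  px short = let i , short′ = neighbour-short k x short in
        short-deck-trivial {k} {flip i x} k∈K (trans (parity-flip i x) (cong not px)) short′

    open Orbits K K-even

    orbit⇒≡ : ∀ {x y} → parity x ≡ false → Orbit x y → q C x ≡ q C y
    orbit⇒≡ {x} px (via k∈K refl) = sym (invariant k∈K x px)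

    -- For n at most 6 all distances are at most 6, so the two vectors are equal. Otherwise `rigid`,
    -- applied to the cover and itself, produces the deck element.
    ≡⇒orbit : ∀ {x y} → parity x ≡ false → parity y ≡ false → q C x ≡ q C y → Orbit x y
    ≡⇒orbit {x} {y} px py eq with 7 ℕ.≤? n
    ... | no 7≰n = subst (Orbit x) (cover-injective C px py
      (ℕ.≤-trans (hamming-≤ x y) (ℕ.≤-pred (ℕ.≰⇒> 7≰n))) eq) orbit-refl
    ... | yes 7≤n = let g , gx≡y , agrees = rigid (ℕ.≤-trans (s≤s (s≤s (s≤s (s≤s (s≤s z≤n))))) 7≤n) C C px py eq in
      via {element = g} (deck
        (trans (cong (_xor parity (proj₁ g)) (sym px)) (trans (sym (parity-act g x)) (trans (cong parity gx≡y) py)))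
        (λ z pz → sym (proj₂ (agrees pz)))
        (inj₂ 7≤n)) gx≡y

    quotient-connected : Connected (Quot K)
    quotient-connected = origin , λ x y → let is , _ , eq , _ = differ y x in
      subst (λ z → Walk (Quot K) z y) eq (walk is)
      where
      walk : ∀ {y} is → Walk (Quot K) (flips is y) y
      walk {y} []  = here (orbit⇒≈ (orbit-refl {y}))
      walk (i ∷ is) = step (flip⇒quot-adj (subst (λ z → Orbit z _) (sym (flip-involutive i _)) orbit-refl)) (walk is)

    quotient-bipartite : Bipartite (Quot K)
    quotient-bipartite = parity ,
      (λ x y x∼y → sym (parity-orbit (≈⇒orbit {x} {y} x∼y))) ,
      (λ x y x~y p → let i , fx∼y = quot-adj⇒flip x y x~y in
        not-¬ p (sym (trans (cong not (trans (parity-orbit fx∼y) (parity-flip i x))) (not-involutive _))))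

    section : Fin m → Vtx n
    section u = proj₁ (onto C u)

    section-even : ∀ u → parity (section u) ≡ false
    section-even u = proj₁ (proj₂ (onto C u))

    q-section : ∀ u → q C (section u) ≡ u
    q-section u = proj₂ (proj₂ (onto C u))

    section-orbit : ∀ {x u} → parity x ≡ false → q C x ≡ u → Orbit x (section u)
    section-orbit {u = u} px eq = ≡⇒orbit px (section-even u) (trans eq (sym (q-section u)))

    halved : HalvedOf (finGraph m E) (Quot K)
    halved = quotient-connected , quotient-bipartite , origin , record
      { f      = λ u → section u , parity-walk K-sparse (trans (parity-origin n) (sym (section-even u)))
      ; f-≈    = λ u v → mk⇔
          (λ u≡v → orbit⇒≈ (subst (λ w → Orbit (section u) (section w)) u≡v orbit-refl))
          (λ su∼sv → trans (sym (q-section u))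
            (trans (orbit⇒≡ (section-even u) (≈⇒orbit {section u} {section v} su∼sv)) (q-section v)))
      ; f-surj = λ (x , w) → q C x , orbit⇒≈ (orbit-sym (section-orbit (trans (walk-parity K-sparse w) (parity-origin n)) refl))
      ; f-adj  = λ u v → mk⇔ (adj⇒dist2 u v) (dist2⇒adj u v)
      }
      where
      adj⇒dist2 : ∀ u v → E u v → _~_ (Dist2 (Quot K)) (section u) (section v)
      adj⇒dist2 u v uv = let i , j , i≢j , eq = lift C (section-even u) (subst (λ w → E w v) (sym (q-section u)) uv) in
        flip²⇒dist2 K-sparse i≢j (section-orbit (trans (parity-flip² i j (section u)) (section-even u)) eq)
      dist2⇒adj : ∀ u v → _~_ (Dist2 (Quot K)) (section u) (section v) → E u v
      dist2⇒adj u v d = let i , j , i≢j , ffu∼v = dist2⇒flip² (section u) (section v) d in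
        subst₂ E (q-section u)
          (trans (orbit⇒≡ (trans (parity-flip² i j (section u)) (section-even u)) ffu∼v) (q-section v))
          (near C (section-even u) i≢j)

  -- Uniqueness up to conjugacy

  module _ {n : ℕ} (K : Subgroup n) (K-even : Even K) (K-sparse : dK≥ K 7) {v₀ : Vtx n} (iso : Iso (finGraph m E) (Induced (Dist2 (Quot K)) (Walk (Dist2 (Quot K)) v₀))) where

    open Orbits K K-even
    open FromHalved K-sparse E iso

    -- A group meeting the bound is the full deck group of its projection: some `k` in it agrees
    -- with `h` at `v₀`, and `h · (k ⁻¹)` is then a deck transformation with a fixed vector, hence
    -- trivial.
    orbit-preserving⇒mem : 3 ≤ n → ∀ {h} → (∀ {x} → parity x ≡ parity v₀ → Orbit x (act h x)) → mem K h
    orbit-preserving⇒mem 3≤n {h} preserves = conclude (preserves refl)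
      where
      conclude : Orbit v₀ (act h v₀) → mem K h
      conclude (via {k} k∈K kv₀≡hv₀) = resp K (act-faithful {g = k} {h = h} k≡h) k∈K
        where
        g : Aut n
        g = h · (k ⁻¹)
        orbit-g : ∀ {x} → parity x ≡ parity v₀ → Orbit x (act g x)
        orbit-g {x} px = orbit-trans (preserves {x} px) (via {element = k ⁻¹} (inv K k∈K) (sym (act-· h (k ⁻¹) x)))
        g-trivial : ∀ x → act g x ≡ x
        g-trivial = deck-fixing-point-trivial 3≤n orbit-cover g
          (λ {x} px → sym (orbit⇒class-≡ px (trans (parity-orbit (orbit-g {x} px)) px) (orbit-g {x} px))) {v₀} refl
          (trans (act-· h (k ⁻¹) v₀) (trans (cong (act (k ⁻¹)) (sym kv₀≡hv₀)) (act-⁻¹-act k v₀)))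
        k≡h : ∀ x → act k x ≡ act h x
        k≡h x = trans (cong (act k) (trans (sym (g-trivial x)) (act-· h (k ⁻¹) x))) (act-act-⁻¹ k (act h x))

  small⇒trivial : {K : Subgroup n} → n ≤ 6 → Even K → dK≥ K 7 → ∀ {k} → mem K k → ∀ x → act k x ≡ x
  small⇒trivial {K = K} n≤6 K-even K-sparse {k} k∈K x =
    Orbits.short⇒fixes K K-even K-sparse {k} {x} k∈K (ℕ.≤-trans (hamming-≤ x (act k x)) n≤6) x

  conjugate : (K L : Subgroup n) → Even K → Even L → dK≥ K 7 → dK≥ L 7 →
    HalvedOf (finGraph m E) (Quot K) → HalvedOf (finGraph m E) (Quot L) → Conjugate K L
  conjugate {n} K L K-even L-even K-sparse L-sparse (_ , _ , v , isoK) (_ , _ , w , isoL) with 7 ℕ.≤? n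
  ... | no 7≰n = e , λ h → mk⇔
    (λ h∈L → trivial∈ K (λ x → trans (conj-e h x) (small⇒trivial {K = L} n≤6 L-even L-sparse h∈L x)))
    (λ h∈K → trivial∈ L (λ x → trans (sym (conj-e h x)) (small⇒trivial {K = K} n≤6 K-even K-sparse h∈K x)))
    where
    n≤6 : n ≤ 6
    n≤6 = ℕ.≤-pred (ℕ.≰⇒> 7≰n)
    trivial∈ : (M : Subgroup n) → ∀ {h} → (∀ x → act h x ≡ x) → mem M h
    trivial∈ M {h} th = resp M (act-faithful {g = e} {h = h} λ x → trans (act-e x) (sym (th x))) (has-e M)
    conj-e : ∀ h x → act ((e · h) · (e ⁻¹)) x ≡ act h x
    conj-e h x = trans (sym (act-e (act ((e · h) · (e ⁻¹)) x))) (trans (act-conj e h x) (cong (act h) (act-e x)))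
  ... | yes 7≤n = conjugate-wide
    where
    module OK = Orbits K K-even
    module OL = Orbits L L-even
    module FK = OK.FromHalved K-sparse E isoK
    module FL = OL.FromHalved L-sparse E isoL
    3≤n : 3 ≤ n
    3≤n = ℕ.≤-trans (s≤s (s≤s (s≤s z≤n))) 7≤n
    -- `rigid` needs a common value of the two covers; the class of `v` is used, lifted to the half
    -- belonging to `L`.
    target : ∃ λ y → parity y ≡ parity w × FL.class y ≡ FK.class v
    target = onto FL.orbit-cover (FK.class v)
    transfer : ∃ λ g → act g v ≡ proj₁ target × (∀ {x} → parity x ≡ parity v → parity (act g x) ≡ parity w × FK.class x ≡ FL.class (act g x))
    transfer = rigid (ℕ.≤-trans (s≤s (s≤s (s≤s (s≤s (s≤s z≤n))))) 7≤n) FK.orbit-cover FL.orbit-cover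
      {v} {proj₁ target} refl (proj₁ (proj₂ target)) (sym (proj₂ (proj₂ target)))
    g : Aut n
    g = proj₁ transfer
    parity-g : ∀ {x} → parity x ≡ parity v → parity (act g x) ≡ parity w
    parity-g {x} px = proj₁ (proj₂ (proj₂ transfer) {x} px)
    class-g : ∀ {x} → parity x ≡ parity v → FK.class x ≡ FL.class (act g x)
    class-g {x} px = proj₂ (proj₂ (proj₂ transfer) {x} px)
    -- An automorphism preserves or exchanges the two parity classes as wholes, so membership in the
    -- half of `L` can be pulled back.
    parity-g⁻ : ∀ {x} → parity (act g x) ≡ parity w → parity x ≡ parity v
    parity-g⁻ {x} p = parity-act-injective g {x} {v} (trans p (sym (parity-g {v} refl)))
    conjugate-wide : Conjugate K L
    conjugate-wide = g , λ h → mk⇔ (L⇒K h) (K⇒L h)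
      where
      conj : Aut n → Aut n
      conj h = (g · h) · (g ⁻¹)
      L⇒K : ∀ h → mem L h → mem K (conj h)
      L⇒K h h∈L = orbit-preserving⇒mem K K-even K-sparse isoK 3≤n {conj h} preserves
        where
        preserves : ∀ {x} → parity x ≡ parity v → OK.Orbit x (act (conj h) x)
        -- By `class-g` the class of x for `K` is that of `act g x` for `L`, and `act-conj` says
        -- that `conj h` does at x what `h` does at `act g x`.
        preserves {x} px = FK.class-≡⇒orbit px pz
          (trans (class-g px) (trans (FL.orbit⇒class-≡ (parity-g {x} px) ph gx∼hgx)
            (trans (cong FL.class (sym (act-conj g h x))) (sym (class-g pz)))))
          where
          gx∼hgx : OL.Orbit (act g x) (act h (act g x))
          gx∼hgx = OL.via {element = h} h∈L refl
          ph : parity (act h (act g x)) ≡ parity w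
          ph = trans (OL.parity-orbit gx∼hgx) (parity-g {x} px)
          pz : parity (act (conj h) x) ≡ parity v
          pz = parity-g⁻ {act (conj h) x} (trans (cong parity (act-conj g h x)) ph)
      K⇒L : ∀ h → mem K (conj h) → mem L h
      K⇒L h h∈K = orbit-preserving⇒mem L L-even L-sparse isoL 3≤n {h} preserves
        where
        preserves-g : ∀ x → parity (act g x) ≡ parity w → OL.Orbit (act g x) (act h (act g x))
        preserves-g x p = FL.class-≡⇒orbit p ph
          (trans (sym (class-g px)) (trans (FK.orbit⇒class-≡ px pz x∼z)
            (trans (class-g pz) (cong FL.class (act-conj g h x)))))
          where
          px : parity x ≡ parity v
          px = parity-g⁻ {x} p
          x∼z : OK.Orbit x (act (conj h) x)
          x∼z = OK.via {element = conj h} h∈K refl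
          pz : parity (act (conj h) x) ≡ parity v
          pz = trans (OK.parity-orbit x∼z) px
          ph : parity (act h (act g x)) ≡ parity w
          ph = trans (cong parity (sym (act-conj g h x))) (parity-g {act (conj h) x} pz)
        preserves : ∀ {y} → parity y ≡ parity w → OL.Orbit y (act h y)
        -- Orbits are compared at vectors of the form `act g x`; every `y` has this form with x =
        -- `act (g ⁻¹) y`.
        preserves {y} py = subst (λ y → OL.Orbit y (act h y)) (act-act-⁻¹ g y)
          (preserves-g (act (g ⁻¹) y) (trans (cong parity (act-act-⁻¹ g y)) py))

theorem1p1 : (n : ℕ) → 2 ≤ n →
    (m : ℕ) (E : Fin m → Fin m → Set) → Symmetric E → (∀ u → ¬ E u u) →
    ((Connected (finGraph m E) × LocallyT n (finGraph m E)) ⇔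
    (∃ λ (K : Subgroup n) → Even K × dK≥ K 7 × HalvedOf (finGraph m E) (Quot K)))
    × ((K L : Subgroup n) → Even K → Even L → dK≥ K 7 → dK≥ L 7 →
    HalvedOf (finGraph m E) (Quot K) → HalvedOf (finGraph m E) (Quot L) →
    Conjugate K L)
theorem1p1 n 2≤n m E E-sym E-irrefl = mk⇔ to from , conjugate E-sym E-irrefl
  where
  to : Connected (finGraph m E) × LocallyT n (finGraph m E) →
    ∃ λ (K : Subgroup n) → Even K × dK≥ K 7 × HalvedOf (finGraph m E) (Quot K)
  to (connected , local) = K , K-even , K-sparse , halved
    where open DeckGroup E-sym E-irrefl 2≤n (locallyT⇒cover E-sym E-irrefl 2≤n connected local)
  from : (∃ λ (K : Subgroup n) → Even K × dK≥ K 7 × HalvedOf (finGraph m E) (Quot K)) →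
    Connected (finGraph m E) × LocallyT n (finGraph m E)
  from (K , K-even , K-sparse , _ , _ , v , iso) =
    covered⇒connected E-sym E-irrefl orbit-cover v , covered⇒locallyT E-sym E-irrefl orbit-cover
    where open Orbits.FromHalved K K-even K-sparse E iso
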